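{- Let $p\geq 2$ and let $G$ be a finite simple $\{pK_2, \overline{P_5}\}$-free graph. Then $\chi(G)\leq f_p(\omega(G))$, where the functions $f_p$ ($p\geq2$) are defined by: $f_t(1)=1$ for $t\geq 2$; $f_2(s)=\frac{3}{2}s$ for $s\geq 2$; $f_p(2)=2p-2$ for $p\geq 3$; and $f_p(m)=m+\sum_{j=2}^{m} f_{p-1}(j)$ for $m,p\geq 3$.
   Context: $\chi(G)$ is the chromatic number and $\omega(G)$ the clique number of $G$. $pK_2$ is the disjoint union of $p$ edges. $\overline{P_5}$ is the complement of the path on five vertices (the "house"). A graph is $\mathcal{F}$-free if it has no induced subgraph isomorphic to a member of $\mathcal{F}$. -}

module Defs where

open import Data.Nat using (ℕ; zero; suc; _+_; _*_; _∸_; _≤_; _<_; _/_)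
open import Data.Nat.Base using (_≡ᵇ_)
open import Data.Bool using (Bool; true; false; _∧_; not)
open import Data.Fin using (Fin; toℕ)
open import Data.Bool.Properties using (∧-zeroʳ)
open import Data.Product using (Σ; _×_; _,_)
open import Relation.Binary.PropositionalEquality using (_≡_; _≢_; refl; trans; cong; cong₂)
open import Function.Definitions using (Injective)
open import Data.Integer using (+_)
import Data.Rational as ℚ
open ℚ using (ℚ)

record Graph : Set where
  field
    n     : ℕ
    Adj   : Fin n → Fin n → Bool
    sym   : ∀ i j → Adj i j ≡ Adj j i
    loopless : ∀ i → Adj i i ≡ false
open Graph public

_InducedIn_ : Graph → Graph → Set
H InducedIn G = Σ (Fin (n H) → Fin (n G)) λ h →
  Injective _≡_ _≡_ h × (∀ i j → Adj H i j ≡ Adj G (h i) (h j))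

_IsFreeOf_ : Graph → Graph → Set
G IsFreeOf H = H InducedIn G → ⊥'
  where open import Data.Empty renaming (⊥ to ⊥')

HasClique : Graph → ℕ → Set
HasClique G k = Σ (Fin k → Fin (n G)) λ h →
  Injective _≡_ _≡_ h × (∀ i j → i ≢ j → Adj G (h i) (h j) ≡ true)

IsCliqueNumber : Graph → ℕ → Set
IsCliqueNumber G ω = HasClique G ω × (∀ k → HasClique G k → k ≤ ω)

Colouring : Graph → ℕ → Set
Colouring G c = Σ (Fin (n G) → Fin c) λ col →
  ∀ i j → Adj G i j ≡ true → col i ≢ col j

IsChromaticNumber : Graph → ℕ → Set
IsChromaticNumber G χ = Colouring G χ × (∀ c → Colouring G c → χ ≤ c)

-- pK₂: vertices 0..2p-1, edges {2i, 2i+1}.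
eqb-sym : ∀ a b → (a ≡ᵇ b) ≡ (b ≡ᵇ a)
eqb-sym zero zero = refl
eqb-sym zero (suc b) = refl
eqb-sym (suc a) zero = refl
eqb-sym (suc a) (suc b) = eqb-sym a b

eqb-false : ∀ a → not (a ≡ᵇ a) ≡ false
eqb-false zero = refl
eqb-false (suc a) = eqb-false a

pK₂ : ℕ → Graph
pK₂ p = record
  { n = p * 2
  ; Adj = λ i j → (toℕ i / 2 ≡ᵇ toℕ j / 2) ∧ not (toℕ i ≡ᵇ toℕ j)
  ; sym = λ i j → cong₂ (λ a b → a ∧ not b) (eqb-sym (toℕ i / 2) (toℕ j / 2)) (eqb-sym (toℕ i) (toℕ j))
  ; loopless = λ i → trans (cong (λ b → (toℕ i / 2 ≡ᵇ toℕ i / 2) ∧ b) (eqb-false (toℕ i))) (∧-zeroʳ _) }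

-- P₅ is the path 0-1-2-3-4; its complement (the house) has i ~ j iff |i-j| ≥ 2.
far : ℕ → ℕ → Bool
far a b = not ((a ∸ b ∸ 1 ≡ᵇ 0) ∧ (b ∸ a ∸ 1 ≡ᵇ 0))

co-P₅ : Graph
co-P₅ = record
  { n = 5
  ; Adj = λ i j → far (toℕ i) (toℕ j)
  ; sym = λ i j → symP (toℕ i) (toℕ j)
  ; loopless = λ i → loopP (toℕ i) }
  where
  open import Data.Bool.Properties using (∧-comm)
  symP : ∀ a b → far a b ≡ far b a
  symP a b = cong not (∧-comm (a ∸ b ∸ 1 ≡ᵇ 0) (b ∸ a ∸ 1 ≡ᵇ 0))
  loopP : ∀ a → far a a ≡ false
  loopP zero = refl
  loopP (suc a) = loopP a

sumFrom2 : (ℕ → ℚ) → ℕ → ℚ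
sumFrom2 g zero = ℚ.0ℚ
sumFrom2 g (suc zero) = ℚ.0ℚ
sumFrom2 g (suc (suc k)) = ℚ._+_ (sumFrom2 g (suc k)) (g (suc (suc k)))

-- f p m  (meaningful for p ≥ 2, m ≥ 1; f p 0 = 0 by convention)
f : ℕ → ℕ → ℚ
f zero m = ℚ.0ℚ
f (suc zero) m = ℚ.0ℚ
f (suc (suc p)) zero = ℚ.0ℚ
f (suc (suc p)) (suc zero) = ℚ.1ℚ
f (suc (suc zero)) (suc (suc s)) = (+ (3 * suc (suc s))) ℚ./ 2
f (suc (suc (suc p))) (suc (suc zero)) = (+ (2 * suc (suc (suc p)) ∸ 2)) ℚ./ 1
f (suc (suc (suc p))) (suc (suc (suc m))) =
  ℚ._+_ ((+ (suc (suc (suc m)))) ℚ./ 1) (sumFrom2 (f (suc (suc p))) (suc (suc (suc m))))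

{-# OPTIONS --safe #-}
module Submission where

open import Defs
open import Data.Bool using (Bool; true; false; _∨_)
import Data.Bool as Bool
open import Data.Empty using (⊥; ⊥-elim)
open import Data.Fin using (Fin; zero; suc; toℕ; fromℕ<)
open import Data.Fin.Patterns using (0F; 1F; 2F; 3F; 4F)
open import Data.Fin.Properties using (any?; all?; toℕ-fromℕ<) renaming (_≟_ to _≟ᶠ_)
open import Data.Integer using (+_)
import Data.Integer as ℤ
import Data.Integer.Properties as ℤₚ
open import Data.List using (List; []; _∷_; _++_; length; filter; allFin; lookup)
open import Data.List.Properties using (filter-accept; filter-reject; length-filter; filter-++; length-++) renaming (≡-dec to List-≡-dec)
open import Data.List.Membership.Propositional using (_∈_)
open import Data.List.Membership.Propositional.Properties using (∈-allFin; ∈-filter⁺; ∈-filter⁻; ∈-lookup)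
open import Data.List.Relation.Unary.All as All using (All; []; _∷_)
import Data.List.Relation.Unary.All.Properties as All
open import Data.List.Relation.Unary.AllPairs using (AllPairs; []; _∷_)
import Data.List.Relation.Unary.AllPairs.Properties as AllPairs
open import Data.List.Relation.Unary.Any as Any using (here; there)
open import Data.Maybe using (Maybe; just; nothing; maybe)
open import Data.Maybe.Properties using (≡-dec)
open import Data.Nat using (ℕ; zero; suc; _+_; _*_; _/_; _≤_; _<_; _≤?_; z≤n; s≤s)
import Data.Nat as ℕ
open import Data.Nat.DivMod using (m/n≡1+[m∸n]/n)
open import Data.Nat.Properties as ℕₚ using (≤-refl; ≤-trans)
open import Data.Product using (Σ; ∃; _×_; _,_; proj₁; proj₂)
import Data.Rational as ℚ
import Data.Rational.Properties as ℚₚ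
import Data.Rational.Unnormalised as ℚᵘ
import Data.Rational.Unnormalised.Properties as ℚᵘₚ
open import Data.Sum using (_⊎_; inj₁; inj₂; [_,_]′)
open import Data.Unit using (⊤; tt)
open import Function using (_∘_)
open import Level using (0ℓ)
open import Relation.Binary.PropositionalEquality as ≡ using (_≡_; _≢_; refl; trans; cong; subst)
open import Relation.Nullary using (¬_; Dec; yes; no; does)
open import Relation.Nullary.Decidable using (from-yes; _×-dec_; _→-dec_; ¬?)
open import Relation.Unary using (Pred; Decidable; _⊆_)

-- A {2K₂, house}-free graph without a vertex whose non-neighbours are independent contains a
-- pentagon; every other vertex is complete to it, anticomplete to it, or a twin of one of its
-- vertices.  The vertices complete to it have clique number at most ω − 2 and the rest is
-- 3-colourable, which gives ⌊3ω/2⌋ colours.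
--
-- For p, m ≥ 3, fix a maximum clique.  The vertices missing just one of its vertices take m
-- colours.  The others are grouped by the second clique vertex they miss; house-freeness splits
-- each group into mutually anticomplete (p−1)K₂-free parts, and the clique numbers of the groups
-- are bounded by m, m−1, …, 2.
--
-- For ω = 2 all reduces to 3K₂-free triangle-free graphs being 4-colourable.  If the vertices
-- missing both ends of some edge induce a bipartite graph, this is clear; otherwise for every
-- edge they form a blown-up pentagon plus isolated vertices.  Fix such an edge uv.  N(v) is one
-- colour class, and each of the five rotations of the 3-colouring of the pentagon is tried on
-- the rest.  If a rotation fails, some isolated vertex z sees all three colours in N(u);
-- combining the failures of all five rotations produces an induced 3K₂.

-- The 5-cycle and its 3-colourings

next : Fin 5 → Fin 5
next 0F = 1F
next 1F = 2F
next 2F = 3F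
next 3F = 4F
next 4F = 0F

next⁵ : ∀ i → next (next (next (next (next i)))) ≡ i
next⁵ = from-yes (all? λ i → next (next (next (next (next i)))) ≟ᶠ i)

opaque
  pentagon : Fin 5 → Fin 5 → Bool
  pentagon i j = does (j ≟ᶠ next i) ∨ does (i ≟ᶠ next j)

  pentagon-sym : ∀ i j → pentagon i j ≡ pentagon j i
  pentagon-sym = from-yes (all? λ i → all? λ j → pentagon i j Bool.≟ pentagon j i)

  pentagon-irrefl : ∀ i → pentagon i i ≡ false
  pentagon-irrefl = from-yes (all? λ i → pentagon i i Bool.≟ false)

  pentagon-next : ∀ i → pentagon i (next i) ≡ true
  pentagon-next = from-yes (all? λ i → pentagon i (next i) Bool.≟ true)

  pentagon-next² : ∀ i → pentagon i (next (next i)) ≡ false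
  pentagon-next² = from-yes (all? λ i → pentagon i (next (next i)) Bool.≟ false)

  pentagon-next³ : ∀ i → pentagon i (next (next (next i))) ≡ false
  pentagon-next³ = from-yes (all? λ i → pentagon i (next (next (next i))) Bool.≟ false)

  pentagon-next⁴ : ∀ i → pentagon i (next (next (next (next i)))) ≡ true
  pentagon-next⁴ = from-yes (all? λ i → pentagon i (next (next (next (next i)))) Bool.≟ true)

  -- Ensures that a pentagon vertex, viewed as a twin, receives its own index as class.
  pentagon-rows : ∀ i j → (∀ k → pentagon i k ≡ pentagon j k) → i ≡ j
  pentagon-rows = from-yes (all? λ i → all? λ j →
    (all? λ k → pentagon i k Bool.≟ pentagon j k) →-dec (i ≟ᶠ j))

  -- Each edge of a 5-cycle has a single opposite vertex; this places two vertices of a blow-up in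
  -- the same class.
  opposite-unique : ∀ α β γ δ → pentagon α β ≡ true → pentagon γ α ≡ false → pentagon γ β ≡ false →
                    pentagon δ α ≡ false → pentagon δ β ≡ false → γ ≡ δ
  opposite-unique = from-yes (all? λ α → all? λ β → all? λ γ → all? λ δ →
    (pentagon α β Bool.≟ true) →-dec (pentagon γ α Bool.≟ false) →-dec (pentagon γ β Bool.≟ false) →-dec
    (pentagon δ α Bool.≟ false) →-dec (pentagon δ β Bool.≟ false) →-dec (γ ≟ᶠ δ))

  opposite-common : ∀ α β γ → pentagon α β ≡ true → pentagon γ α ≡ false → pentagon γ β ≡ false →
                    ∃ λ i → pentagon β i ≡ true × pentagon γ i ≡ true
  opposite-common = from-yes (all? λ α → all? λ β → all? λ γ →
    (pentagon α β Bool.≟ true) →-dec (pentagon γ α Bool.≟ false) →-dec (pentagon γ β Bool.≟ false) →-dec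
    any? λ i → (pentagon β i Bool.≟ true) ×-dec (pentagon γ i Bool.≟ true))

-- Stands in for arithmetic modulo 5: matching on the difference of two indices gives five cases
-- uniform in `i`.
data Offset (i : Fin 5) : Fin 5 → Set where
  same    : Offset i i
  ahead   : Offset i (next i)
  ahead²  : Offset i (next (next i))
  behind² : Offset i (next (next (next i)))
  behind  : Offset i (next (next (next (next i))))

offset : ∀ i j → Offset i j
offset 0F 0F = same
offset 0F 1F = ahead
offset 0F 2F = ahead²
offset 0F 3F = behind²
offset 0F 4F = behind
offset 1F 0F = behind
offset 1F 1F = same
offset 1F 2F = ahead
offset 1F 3F = ahead²
offset 1F 4F = behind²
offset 2F 0F = behind²
offset 2F 1F = behind
offset 2F 2F = same
offset 2F 3F = ahead
offset 2F 4F = ahead²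
offset 3F 0F = ahead²
offset 3F 1F = behind²
offset 3F 2F = behind
offset 3F 3F = same
offset 3F 4F = ahead
offset 4F 0F = ahead
offset 4F 1F = ahead²
offset 4F 2F = behind²
offset 4F 3F = behind
offset 4F 4F = same

offsetColour : ∀ {r i} → Offset r i → ℕ
offsetColour same    = 2
offsetColour ahead   = 0
offsetColour ahead²  = 1
offsetColour behind² = 0
offsetColour behind  = 1

-- The proper 3-colouring of the 5-cycle that uses colour 2 at r only.
pentagonColour : Fin 5 → Fin 5 → ℕ
pentagonColour r i = offsetColour (offset r i)

pentagonColour<3 : ∀ r i → pentagonColour r i < 3
pentagonColour<3 = from-yes (all? λ r → all? λ i → pentagonColour r i ℕₚ.<? 3)

opaque
  unfolding pentagon

  pentagonColour-proper : ∀ r i j → pentagon i j ≡ true → pentagonColour r i ≢ pentagonColour r j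
  pentagonColour-proper = from-yes (all? λ r → all? λ i → all? λ j →
    (pentagon i j Bool.≟ true) →-dec ¬? (pentagonColour r i ℕₚ.≟ pentagonColour r j))

-- `nothing` is an isolated vertex added to the 5-cycle.
pentagon+1 : Maybe (Fin 5) → Maybe (Fin 5) → Bool
pentagon+1 (just i) (just j) = pentagon i j
pentagon+1 _        _        = false

-- `P` and `Q` need not be complementary, so the second alternative can carry data, such as a
-- blow-up or a spare colour for every index.
search : ∀ {k} {P Q : Fin k → Set} → (∀ i → P i ⊎ Q i) → ∃ P ⊎ (∀ i → Q i)
search {zero}  d = inj₂ λ ()
search {suc k} d with d zero | search (d ∘ suc)
... | inj₁ p | _            = inj₁ (zero , p)
... | inj₂ _ | inj₁ (i , p) = inj₁ (suc i , p)
... | inj₂ q | inj₂ qs      = inj₂ λ { zero → q ; (suc i) → qs i }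

-- Numerical bounds

-- ⌊ 3 m / 2 ⌋
threeHalves : ℕ → ℕ
threeHalves 0 = 0
threeHalves 1 = 1
threeHalves (suc (suc m)) = 3 + threeHalves m

threeHalves-suc : ∀ m → suc (threeHalves m) ≤ threeHalves (suc m)
threeHalves-suc 0 = ≤-refl
threeHalves-suc 1 = ℕₚ.n≤1+n 2
threeHalves-suc (suc (suc m)) = ℕₚ.+-monoʳ-≤ 3 (threeHalves-suc m)

sum₂ : (ℕ → ℕ) → ℕ → ℕ
sum₂ g 0 = 0
sum₂ g 1 = 0
sum₂ g (suc (suc m)) = sum₂ g (suc m) + g (suc (suc m))

-- χ-bound p is the paper's f_{p+2}, with f_2 rounded down.
χ-bound : ℕ → ℕ → ℕ
χ-bound zero    m = threeHalves m
χ-bound (suc p) 0 = 0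
χ-bound (suc p) 1 = 1
χ-bound (suc p) 2 = 4 + 2 * p
χ-bound (suc p) m@(suc (suc (suc _))) = m + sum₂ (χ-bound p) m

-- Covers the case that no clique attains the assumed bound `3 + m`: a colouring for `2 + m` is then
-- good enough.
χ-bound-suc : ∀ p m → χ-bound (suc p) (2 + m) ≤ χ-bound (suc p) (3 + m)
-- `χ-bound 1 3` is 3 + (3 + 4).
χ-bound-suc zero    zero    = from-yes (4 ≤? 10)
χ-bound-suc (suc p) zero    = begin
  4 + 2 * suc p                              ≡⟨ cong (4 ℕ.+_) (ℕₚ.*-suc 2 p) ⟩
  6 + 2 * p                                  ≤⟨ ℕₚ.n≤1+n _ ⟩
  3 + χ-bound (suc p) 2                      ≤⟨ ℕₚ.+-monoʳ-≤ 3 (ℕₚ.m≤m+n _ _) ⟩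
  3 + (χ-bound (suc p) 2 + χ-bound (suc p) 3) ∎
  where open ℕₚ.≤-Reasoning
χ-bound-suc p       (suc m) = ℕₚ.+-mono-≤ (ℕₚ.n≤1+n (3 + m)) (ℕₚ.m≤m+n (sum₂ (χ-bound p) (3 + m)) _)

-- Makes every adjacency-preserving map from the house injective.
co-P₅-rows : ∀ i j → (∀ k → Adj co-P₅ i k ≡ Adj co-P₅ j k) → i ≡ j
co-P₅-rows = from-yes (all? λ i → all? λ j →
  (all? λ k → Adj co-P₅ i k Bool.≟ Adj co-P₅ j k) →-dec (i ≟ᶠ j))

2+m/2 : ∀ m → (2 + m) / 2 ≡ suc (m / 2)
2+m/2 m = m/n≡1+[m∸n]/n {2 + m} {2} (s≤s (s≤s z≤n))

-- Vertex sets, induced matchings, cliques and colourings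

module Graphs (G : Graph) where

  V : Set
  V = Fin (n G)

  VertexSet : Set₁
  VertexSet = Pred V 0ℓ

  infix 4 _~_ _≁_

  _~_ _≁_ : V → V → Set
  x ~ y = Adj G x y ≡ true
  x ≁ y = Adj G x y ≡ false

  ~-sym : ∀ {x y} → x ~ y → y ~ x
  ~-sym {x} {y} = trans (sym G y x)

  ≁-sym : ∀ {x y} → x ≁ y → y ≁ x
  ≁-sym {x} {y} = trans (sym G y x)

  ≁-refl : ∀ {x} → x ≁ x
  ≁-refl {x} = loopless G x

  clash : ∀ {x y} → x ~ y → x ≁ y → ⊥
  clash p q with trans (≡.sym p) q
  ... | ()

  _~?_ : ∀ x y → Dec (x ~ y)
  x ~? y = Adj G x y Bool.≟ true

  ~⊎≁ : ∀ x y → x ~ y ⊎ x ≁ y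
  ~⊎≁ x y with Adj G x y
  ... | true  = inj₁ refl
  ... | false = inj₂ refl

  ¬~⇒≁ : ∀ {x y} → ¬ x ~ y → x ≁ y
  ¬~⇒≁ {x} {y} ¬p with ~⊎≁ x y
  ... | inj₁ p = ⊥-elim (¬p p)
  ... | inj₂ q = q

  ¬≁⇒~ : ∀ {x y} → ¬ x ≁ y → x ~ y
  ¬≁⇒~ {x} {y} ¬q with ~⊎≁ x y
  ... | inj₁ p = p
  ... | inj₂ q = ⊥-elim (¬q q)

  Nbrs NonNbrs : VertexSet → V → VertexSet
  Nbrs    S v w = S w × v ~ w
  NonNbrs S v w = S w × v ≁ w

  Nbrs? : ∀ {S} → Decidable S → ∀ v → Decidable (Nbrs S v)
  Nbrs? S? v w = S? w ×-dec (v ~? w)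

  NonNbrs? : ∀ {S} → Decidable S → ∀ v → Decidable (NonNbrs S v)
  NonNbrs? S? v w = S? w ×-dec (Adj G v w Bool.≟ false)

  Independent : VertexSet → Set
  Independent S = ∀ {x y} → S x → S y → x ≁ y

  Away : VertexSet → V → V → VertexSet
  Away S u v w = S w × u ≁ w × v ≁ w

  Away? : ∀ {S} → Decidable S → ∀ u v → Decidable (Away S u v)
  Away? S? u v w = S? w ×-dec ((Adj G u w Bool.≟ false) ×-dec (Adj G v w Bool.≟ false))

  edge⊎independent : ∀ {S} → Decidable S → (∃ λ u → ∃ λ v → S u × S v × u ~ v) ⊎ Independent S
  edge⊎independent S? with any? (λ u → any? λ v → S? u ×-dec (S? v ×-dec (u ~? v)))
  ... | yes edge = inj₁ edge
  ... | no none  = inj₂ λ x∈ y∈ → ¬~⇒≁ λ xy → none (_ , _ , x∈ , y∈ , xy)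

  -- An induced pK₂, peeled edge by edge: the later edges lie in the part anticomplete to the first
  -- one, which suits induction on `p`.
  Matching : ℕ → VertexSet → Set
  Matching zero    S = ⊤
  Matching (suc p) S = ∃ λ u → ∃ λ v → S u × S v × u ~ v × Matching p (Away S u v)

  Matching-mono : ∀ p {S T} → S ⊆ T → Matching p S → Matching p T
  Matching-mono zero    S⊆T _ = tt
  Matching-mono (suc p) S⊆T (u , v , u∈ , v∈ , u~v , M) =
    u , v , S⊆T u∈ , S⊆T v∈ , u~v , Matching-mono p (λ (w∈ , q) → S⊆T w∈ , q) M

  matching₁ : ∀ {S a b} → S a → S b → a ~ b → Matching 1 S
  matching₁ a∈ b∈ ab = _ , _ , a∈ , b∈ , ab , tt

  matching₂ : ∀ {S a b c d} → S a → S b → S c → S d → a ~ b → c ~ d →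
              a ≁ c → a ≁ d → b ≁ c → b ≁ d → Matching 2 S
  matching₂ a∈ b∈ c∈ d∈ ab cd ac ad bc bd =
    _ , _ , a∈ , b∈ , ab , matching₁ (c∈ , ac , bc) (d∈ , ad , bd) cd

  Clique : VertexSet → List V → Set
  Clique S Q = All S Q × AllPairs _~_ Q

  -- An upper bound instead of the exact clique number, so that it passes to subsets.
  ω≤ : VertexSet → ℕ → Set
  ω≤ S m = ∀ Q → Clique S Q → length Q ≤ m

  ω≤-mono : ∀ {S T m} → S ⊆ T → ω≤ T m → ω≤ S m
  ω≤-mono S⊆T ω Q (Q∈ , Q~) = ω Q (All.map S⊆T Q∈ , Q~)

  ω≤-Nbrs : ∀ {S v m} → S v → ω≤ S (suc m) → ω≤ (Nbrs S v) m
  ω≤-Nbrs {v = v} v∈ ω Q (Q∈ , Q~) =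
    ℕₚ.≤-pred (ω (v ∷ Q) (v∈ ∷ All.map proj₁ Q∈ , All.map proj₂ Q∈ ∷ Q~))

  ω≤0⇒empty : ∀ {S} → ω≤ S 0 → ∀ {x} → ¬ S x
  ω≤0⇒empty ω {x} x∈ with ω (x ∷ []) (x∈ ∷ [] , [] ∷ [])
  ... | ()

  ω≤1⇒independent : ∀ {S} → ω≤ S 1 → Independent S
  ω≤1⇒independent ω {x} {y} x∈ y∈ = ¬~⇒≁ λ xy → ω≤0⇒empty (ω≤-Nbrs x∈ ω) (y∈ , xy)

  ω≤2⇒triangleFree : ∀ {S} → ω≤ S 2 → ∀ {x y z} → S x → S y → S z → x ~ y → x ~ z → y ≁ z
  ω≤2⇒triangleFree ω x∈ y∈ z∈ xy xz = ω≤1⇒independent (ω≤-Nbrs x∈ ω) (y∈ , xy) (z∈ , xz)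

  -- Branches on the first vertex and looks for the remaining `m` vertices in its neighbourhood.
  findClique : ∀ m {S} → Decidable S →
               (∃ λ Q → Clique S Q × length Q ≡ m) ⊎ (∀ Q → Clique S Q → length Q < m)
  findClique zero    S? = inj₁ ([] , ([] , []) , refl)
  findClique (suc m) {S} S? with search at
    where
    Found Bounded : V → Set
    Found v = S v × ∃ λ Q → Clique (Nbrs S v) Q × length Q ≡ m
    Bounded v = S v → ∀ Q → Clique (Nbrs S v) Q → length Q < m
    at : ∀ v → Found v ⊎ Bounded v
    at v with S? v | findClique m (Nbrs? S? v)
    ... | no v∉  | _          = inj₂ λ v∈ → ⊥-elim (v∉ v∈)
    ... | yes v∈ | inj₁ found = inj₁ (v∈ , found)
    ... | yes v∈ | inj₂ bound = inj₂ λ _ → bound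
  ... | inj₁ (v , v∈ , Q , (Q∈ , Q~) , refl) =
    inj₁ (v ∷ Q , (v∈ ∷ All.map proj₁ Q∈ , All.map proj₂ Q∈ ∷ Q~) , refl)
  ... | inj₂ bound = inj₂ λ
    { [] _ → s≤s z≤n
    ; (v ∷ Q) (v∈ ∷ Q∈ , v~ ∷ Q~) → s≤s (bound v v∈ Q (All.zip (Q∈ , v~) , Q~)) }

  -- The colour is defined on all vertices but constrained on `S` only, so colourings of different
  -- parts combine directly.
  record Colourable (S : VertexSet) (k : ℕ) : Set where
    field
      colour : V → ℕ
      bound  : ∀ {x} → S x → colour x < k
      proper : ∀ {x y} → S x → S y → x ~ y → colour x ≢ colour y
  open Colourable

  Colourable-mono : ∀ {S T k l} → S ⊆ T → k ≤ l → Colourable T k → Colourable S l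
  Colourable-mono S⊆T k≤l C .colour = C .colour
  Colourable-mono S⊆T k≤l C .bound x∈ = ≤-trans (C .bound (S⊆T x∈)) k≤l
  Colourable-mono S⊆T k≤l C .proper x∈ y∈ = C .proper (S⊆T x∈) (S⊆T y∈)

  Colourable-empty : ∀ {S k} → (∀ {x} → ¬ S x) → Colourable S k
  Colourable-empty ∅ .colour _ = 0
  Colourable-empty ∅ .bound x∈ = ⊥-elim (∅ x∈)
  Colourable-empty ∅ .proper x∈ = ⊥-elim (∅ x∈)

  Colourable-independent : ∀ {S} → Independent S → Colourable S 1
  Colourable-independent I .colour _ = 0
  Colourable-independent I .bound _ = s≤s z≤n
  Colourable-independent I .proper x∈ y∈ xy _ = clash xy (I x∈ y∈)

  -- Shifting the second palette by `k` makes the palettes disjoint, so edges between the two parts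
  -- are harmless.
  Colourable-∪ : ∀ {S T U k l} → Decidable T → (∀ {x} → S x → ¬ T x → U x) →
                 Colourable T k → Colourable U l → Colourable S (k + l)
  Colourable-∪ {S} {T} {U} {k} {l} T? cover C D = record
    { colour = col ; bound = bound′ ; proper = proper′ }
    where
    col : V → ℕ
    col x with T? x
    ... | yes _ = C .colour x
    ... | no  _ = k + D .colour x
    bound′ : ∀ {x} → S x → col x < k + l
    bound′ {x} x∈ with T? x
    ... | yes x∈T = ≤-trans (C .bound x∈T) (ℕₚ.m≤m+n k l)
    ... | no  x∉T = ℕₚ.+-monoʳ-< k (D .bound (cover x∈ x∉T))
    proper′ : ∀ {x y} → S x → S y → x ~ y → col x ≢ col y
    proper′ {x} {y} x∈ y∈ xy with T? x | T? y
    ... | yes x∈T | yes y∈T = C .proper x∈T y∈T xy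
    ... | yes x∈T | no  _   = ℕₚ.<⇒≢ (≤-trans (C .bound x∈T) (ℕₚ.m≤m+n k _))
    ... | no  _   | yes y∈T = ℕₚ.<⇒≢ (≤-trans (C .bound y∈T) (ℕₚ.m≤m+n k _)) ∘ ≡.sym
    ... | no  x∉T | no  y∉T = D .proper (cover x∈ x∉T) (cover y∈ y∉T) xy ∘ ℕₚ.+-cancelˡ-≡ k _ _

  -- The fibres are mutually anticomplete in `S` and can share one palette.
  Colourable-fibres : ∀ {S k} (label : V → V) →
                      (∀ {x y} → S x → S y → x ~ y → label x ≡ label y) →
                      (∀ i → Colourable (λ x → S x × label x ≡ i) k) → Colourable S k
  Colourable-fibres label const C .colour x = C (label x) .colour x
  Colourable-fibres label const C .bound x∈ = C _ .bound (x∈ , refl)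
  Colourable-fibres label const C .proper {x} {y} x∈ y∈ xy
    rewrite const x∈ y∈ xy = C (label y) .proper (x∈ , const x∈ y∈ xy) (y∈ , refl) xy

  -- Pentagons, blow-ups and houses

  record Pentagon (S : VertexSet) : Set where
    field
      c       : Fin 5 → V
      c∈      : ∀ i → S (c i)
      c~next  : ∀ i → c i ~ c (next i)
      c≁next² : ∀ i → c i ≁ c (next (next i))

    c≁next³ : ∀ i → c i ≁ c (next (next (next i)))
    c≁next³ i = ≁-sym (subst (λ j → c (next (next (next i))) ≁ c j) (next⁵ i) (c≁next² _))

    c~next⁴ : ∀ i → c i ~ c (next (next (next (next i))))
    c~next⁴ i = ~-sym (subst (λ j → c (next (next (next (next i)))) ~ c j) (next⁵ i) (c~next _))

    c-adj : ∀ i j → Adj G (c i) (c j) ≡ pentagon i j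
    c-adj i j with offset i j
    ... | same    = trans ≁-refl (≡.sym (pentagon-irrefl i))
    ... | ahead   = trans (c~next i) (≡.sym (pentagon-next i))
    ... | ahead²  = trans (c≁next² i) (≡.sym (pentagon-next² i))
    ... | behind² = trans (c≁next³ i) (≡.sym (pentagon-next³ i))
    ... | behind  = trans (c~next⁴ i) (≡.sym (pentagon-next⁴ i))

  -- A 5-cycle with vertices replaced by independent classes, plus isolated vertices of class
  -- `nothing`; `rep` makes all five classes nonempty.
  record Blowup (S : VertexSet) : Set where
    field
      class     : V → Maybe (Fin 5)
      class-adj : ∀ {x y} → S x → S y → Adj G x y ≡ pentagon+1 (class x) (class y)
      rep       : Fin 5 → V
      rep∈      : ∀ i → S (rep i)
      rep-class : ∀ i → class (rep i) ≡ just i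

  Colourable-blowup : ∀ {S} → Blowup S → Colourable S 3
  Colourable-blowup {S} B = record { colour = col ; bound = λ {x} _ → col<3 x ; proper = col-proper }
    where
    open Blowup B
    col : V → ℕ
    -- The rotation is arbitrary, and an isolated vertex may take any colour.
    col x = maybe (pentagonColour 0F) 0 (class x)
    col<3 : ∀ x → col x < 3
    col<3 x with class x
    ... | just i  = pentagonColour<3 0F i
    ... | nothing = s≤s z≤n
    col-proper : ∀ {x y} → S x → S y → x ~ y → col x ≢ col y
    col-proper {x} {y} x∈ y∈ xy with class x | class y | trans (≡.sym (class-adj x∈ y∈)) xy
    ... | just i | just j | ij = pentagonColour-proper 0F i j ij

  -- The square is a, b, c, d and the roof e sits over the edge ab. The adjacencies alone force five
  -- distinct vertices.
  HouseFree : Set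
  HouseFree = ∀ {a b c d e} → a ~ b → b ~ c → c ~ d → d ~ a → e ~ a → e ~ b →
              a ≁ c → b ≁ d → e ≁ c → e ≁ d → ⊥

  maximal : {_⊑_ : V → V → Set} → (∀ x → x ⊑ x) → (∀ {x y z} → x ⊑ y → y ⊑ z → x ⊑ z) →
            (∀ x y → Dec (x ⊑ y)) → {S : VertexSet} → Decidable S →
            (∀ {x} → ¬ S x) ⊎ (∃ λ m → S m × ∀ {y} → S y → m ⊑ y → y ⊑ m)
  maximal {_⊑_} ⊑-refl ⊑-trans _⊑?_ {S} S? with among (allFin (n G))
    where
    among : ∀ xs → (∀ {x} → x ∈ xs → ¬ S x) ⊎
                   (∃ λ m → S m × ∀ {y} → y ∈ xs → S y → m ⊑ y → y ⊑ m)
    among [] = inj₁ λ ()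
    among (x ∷ xs) with S? x | among xs
    ... | no x∉  | inj₁ ∅ = inj₁ λ { (here refl) → x∉ ; (there y∈) → ∅ y∈ }
    ... | no x∉  | inj₂ (m , m∈ , max) =
      inj₂ (m , m∈ , λ { (here refl) x∈ → ⊥-elim (x∉ x∈) ; (there y∈) → max y∈ })
    ... | yes x∈ | inj₁ ∅ =
      inj₂ (x , x∈ , λ { (here refl) _ _ → ⊑-refl x ; (there y∈) y∈S → ⊥-elim (∅ y∈ y∈S) })
    ... | yes x∈ | inj₂ (m , m∈ , max) with m ⊑? x
    ...   | yes m⊑x = inj₂ (x , x∈ , λ
      { (here refl) _ _ → ⊑-refl x
      ; (there y∈) y∈S x⊑y → ⊑-trans (max y∈ y∈S (⊑-trans m⊑x x⊑y)) m⊑x })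
    ...   | no m⋢x = inj₂ (m , m∈ , λ
      { (here refl) _ m⊑x → ⊥-elim (m⋢x m⊑x)
      ; (there y∈) → max y∈ })
  ... | inj₁ ∅ = inj₁ λ {x} → ∅ (∈-allFin x)
  ... | inj₂ (m , m∈ , max) = inj₂ (m , m∈ , λ {y} → max (∈-allFin y))

  -- With v of inclusionwise maximal neighbourhood, an edge ab missing v yields neighbours a′ ≁ a
  -- and b′ ≁ b of v; then a, b, a′, v, b′ form a pentagon or a house.
  cosimplicial⊎pentagon : HouseFree → ∀ {S} → Decidable S → ¬ Matching 2 S →
    (∀ {x} → ¬ S x) ⊎ (∃ λ v → S v × Independent (NonNbrs S v)) ⊎ Pentagon S
  cosimplicial⊎pentagon houseFree {S} S? ¬2K₂
    with maximal {λ x y → ∀ w → Nbrs S x w → y ~ w} (λ x w → proj₂)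
                 (λ p q w (w∈ , xw) → q w (w∈ , p w (w∈ , xw)))
                 (λ x y → all? λ w → Nbrs? S? x w →-dec (y ~? w)) S?
  ... | inj₁ ∅ = inj₁ ∅
  ... | inj₂ (v , v∈ , max)
    with edge⊎independent (NonNbrs? S? v)
  ... | inj₂ I = inj₂ (inj₁ (v , v∈ , I))
  ... | inj₁ (a , b , (a∈ , va) , (b∈ , vb) , ab) = inj₂ (inj₂ found)
    where
    -- If `a` saw all neighbours of `v`, maximality would make `v` see all neighbours of `a` in `S`,
    -- among them `b`.
    escape : ∀ {a b} → S a → S b → v ≁ b → a ~ b → ∃ λ w → Nbrs S v w × a ≁ w
    escape {a} {b} a∈ b∈ vb ab
      with any? (λ w → Nbrs? S? v w ×-dec (Adj G a w Bool.≟ false))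
    ... | yes found = found
    ... | no none = ⊥-elim (clash (max a∈ (λ w w∈ → ¬≁⇒~ λ aw → none (w , w∈ , aw)) b (b∈ , ab)) vb)

    found : Pentagon S
    found with escape a∈ b∈ vb ab | escape b∈ a∈ va (~-sym ab)
    ... | a′ , (a′∈ , va′) , aa′ | b′ , (b′∈ , vb′) , bb′ = record
      { c = c ; c∈ = c∈ ; c~next = c~next ; c≁next² = c≁next² }
      where
      ba′ : b ~ a′
      ba′ = ¬≁⇒~ λ q → ¬2K₂ (matching₂ v∈ a′∈ a∈ b∈ va′ ab va vb (≁-sym aa′) (≁-sym q))
      ab′ : a ~ b′
      ab′ = ¬≁⇒~ λ q → ¬2K₂ (matching₂ v∈ b′∈ a∈ b∈ vb′ ab va vb (≁-sym q) (≁-sym bb′))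
      a′b′ : a′ ≁ b′
      a′b′ = ¬~⇒≁ λ p → houseFree p (~-sym ab′) ab ba′ va′ vb′ (≁-sym aa′) (≁-sym bb′) va vb
      c : Fin 5 → V
      c 0F = v
      c 1F = a′
      c 2F = b
      c 3F = a
      c 4F = b′
      c∈ : ∀ i → S (c i)
      c∈ 0F = v∈
      c∈ 1F = a′∈
      c∈ 2F = b∈
      c∈ 3F = a∈
      c∈ 4F = b′∈
      c~next : ∀ i → c i ~ c (next i)
      c~next 0F = va′
      c~next 1F = ~-sym ba′
      c~next 2F = ~-sym ab
      c~next 3F = ab′
      c~next 4F = ~-sym vb′
      c≁next² : ∀ i → c i ≁ c (next (next i))
      c≁next² 0F = vb
      c≁next² 1F = ≁-sym aa′
      c≁next² 2F = bb′
      c≁next² 3F = ≁-sym va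
      c≁next² 4F = ≁-sym a′b′

  -- How vertices attach to a pentagon

  module AroundPentagon (houseFree : HouseFree) {S : VertexSet} (¬2K₂ : ¬ Matching 2 S)
                        (C : Pentagon S) where
    open Pentagon C

    next⁵~ : ∀ {x} i → x ~ c i → x ~ c (next (next (next (next (next i)))))
    next⁵~ {x} i = subst (λ j → x ~ c j) (≡.sym (next⁵ i))

    Full : VertexSet
    Full x = ∀ i → x ~ c i

    Full? : Decidable Full
    Full? x = all? λ i → x ~? c i

    -- Otherwise the edge from `x` to `c i` and the pentagon edge facing `c i` form an induced 2K₂.
    opposite : ∀ {x} → S x → ∀ i → x ~ c i → x ≁ c (next (next i)) → x ~ c (next (next (next i)))
    opposite x∈ i x~i x≁i+2 = ¬≁⇒~ λ x≁i+3 →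
      ¬2K₂ (matching₂ x∈ (c∈ i) (c∈ _) (c∈ _) x~i (c~next _) x≁i+2 x≁i+3 (c≁next² i) (c≁next³ i))

    -- If `x` missed the vertex at i + 2, it would see the one at i + 3 by `opposite`; then `x` and
    -- the vertices at i + 1, i + 2, i + 3 form a square with roof `c i`.
    consecutive : ∀ {x} → S x → ∀ i → x ~ c i → x ~ c (next i) → x ~ c (next (next i))
    consecutive x∈ i x~i x~i+1 = ¬≁⇒~ λ x≁i+2 →
      houseFree x~i+1 (c~next _) (c~next _) (~-sym (opposite x∈ i x~i x≁i+2)) (~-sym x~i)
                (c~next i) x≁i+2 (c≁next² _) (c≁next² i) (c≁next³ i)

    consecutive⇒full : ∀ {x} → S x → ∀ i → x ~ c i → x ~ c (next i) → Full x
    consecutive⇒full {x} x∈ i x₀ x₁ j = from (offset i j)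
      where
      x₂ = consecutive x∈ i x₀ x₁
      x₃ = consecutive x∈ _ x₁ x₂
      x₄ = consecutive x∈ _ x₂ x₃
      from : Offset i j → x ~ c j
      from same    = x₀
      from ahead   = x₁
      from ahead²  = x₂
      from behind² = x₃
      from behind  = x₄

    Twin : Fin 5 → VertexSet
    Twin i x = ∀ j → Adj G x (c j) ≡ pentagon i j

    twin? : ∀ x → Dec (∃ λ i → Twin i x)
    twin? x = any? λ i → all? λ j → Adj G x (c j) Bool.≟ pentagon i j

    -- Each of the other three pentagon vertices is next to one of the two seen, so `x` sees none of
    -- them: two consecutive neighbours would make it full.
    straddle : ∀ {x} i → S x → ¬ Full x → x ~ c i → x ~ c (next (next i)) → Twin (next i) x
    straddle {x} i x∈ ¬full x₀ x₂ j = from (offset i j)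
      where
      lone : ∀ k → x ~ c k → x ≁ c (next k)
      lone k xk = ¬~⇒≁ (¬full ∘ consecutive⇒full x∈ k xk)
      x₄ : x ≁ c (next (next (next (next i))))
      x₄ = ¬~⇒≁ λ p → ¬full (consecutive⇒full x∈ _ p (next⁵~ i x₀))
      from : Offset i j → Adj G x (c j) ≡ pentagon (next i) j
      from same    = trans x₀ (≡.sym (trans (pentagon-sym (next i) i) (pentagon-next i)))
      from ahead   = trans (lone i x₀) (≡.sym (pentagon-irrefl _))
      from ahead²  = trans x₂ (≡.sym (pentagon-next _))
      from behind² = trans (lone _ x₂) (≡.sym (pentagon-next² _))
      from behind  = trans x₄ (≡.sym (trans (pentagon-sym (next i) _)
        (subst (λ k → pentagon (next (next (next (next i)))) (next k) ≡ false) (next⁵ i) (pentagon-next² _))))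

    -- A vertex seeing `c i` also sees the vertex at i + 2 or, by `opposite`, at i + 3; `straddle`
    -- applies to either pair.
    twin⊎isolated : ∀ {x} → S x → ¬ Full x → (∃ λ i → Twin i x) ⊎ (∀ i → x ≁ c i)
    twin⊎isolated {x} x∈ ¬full with any? (λ i → x ~? c i)
    ... | no none = inj₂ λ i → ¬~⇒≁ λ xi → none (i , xi)
    ... | yes (i , xi) with ~⊎≁ x (c (next (next i)))
    ...   | inj₁ x₂ = inj₁ (_ , straddle i x∈ ¬full xi x₂)
    ...   | inj₂ x₂ = inj₁ (_ , straddle _ x∈ ¬full (opposite x∈ i xi x₂) (next⁵~ i xi))

    at : ∀ {x i j b} → Twin i x → pentagon i j ≡ b → Adj G x (c j) ≡ b
    at t p = trans (t _) p

    module _ {x y : V} (x∈ : S x) (y∈ : S y) where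

      twins-same : ∀ i → Twin i x → Twin i y → x ≁ y
      twins-same i tx ty = ¬~⇒≁ λ xy → ¬2K₂ (matching₂ x∈ y∈ (c∈ _) (c∈ _) xy (c~next _)
        (at tx (pentagon-next² i)) (at tx (pentagon-next³ i)) (at ty (pentagon-next² i)) (at ty (pentagon-next³ i)))

      -- Otherwise `x` with the vertex at i - 1 and `y` with the vertex at i + 2 form an induced
      -- 2K₂.
      twins-next : ∀ i → Twin i x → Twin (next i) y → x ~ y
      twins-next i tx ty = ¬≁⇒~ λ xy → ¬2K₂ (matching₂ x∈ (c∈ _) y∈ (c∈ _)
        (at tx (pentagon-next⁴ i)) (at ty (pentagon-next (next i))) xy (at tx (pentagon-next² i))
        (≁-sym (at ty (pentagon-next³ _))) (≁-sym (c≁next² _)))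

      -- An edge xy would close a square with the vertices at i + 3 and i + 4, roofed by the vertex
      -- at i + 1.
      twins-next² : ∀ i → Twin i x → Twin (next (next i)) y → x ≁ y
      twins-next² i tx ty = ¬~⇒≁ λ xy → houseFree xy
        (at ty (pentagon-next _)) (c~next _) (~-sym (at tx (pentagon-next⁴ i)))
        (~-sym (at tx (pentagon-next i))) (~-sym (at ty (trans (pentagon-sym _ _) (pentagon-next (next i)))))
        (at tx (pentagon-next³ i)) (at ty (pentagon-next² _))
        (c≁next² _) (c≁next³ _)

      isolated-twin : (∀ i → x ≁ c i) → ∀ j → Twin j y → x ≁ y
      isolated-twin x≁ j ty = ¬~⇒≁ λ xy → ¬2K₂ (matching₂ x∈ y∈ (c∈ _) (c∈ _) xy (c~next _)
        (x≁ _) (x≁ _) (at ty (pentagon-next² j)) (at ty (pentagon-next³ j)))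

      isolated-isolated : (∀ i → x ≁ c i) → (∀ i → y ≁ c i) → x ≁ y
      isolated-isolated x≁ y≁ = ¬~⇒≁ λ xy → ¬2K₂ (matching₂ x∈ y∈ (c∈ _) (c∈ _) xy (c~next 0F)
        (x≁ _) (x≁ _) (y≁ _) (y≁ _))

    twins-adj : ∀ {x y} → S x → S y → ∀ i j → Twin i x → Twin j y → Adj G x y ≡ pentagon i j
    twins-adj {x} {y} x∈ y∈ i j tx ty with offset i j
    ... | same   = trans (twins-same x∈ y∈ i tx ty) (≡.sym (pentagon-irrefl i))
    ... | ahead  = trans (twins-next x∈ y∈ i tx ty) (≡.sym (pentagon-next i))
    ... | ahead² = trans (twins-next² x∈ y∈ i tx ty) (≡.sym (pentagon-next² i))
    ... | behind² = trans (≁-sym (twins-next² y∈ x∈ _ ty (subst (λ k → Twin k x) (≡.sym (next⁵ i)) tx)))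
                          (≡.sym (pentagon-next³ i))
    ... | behind = trans (~-sym (twins-next y∈ x∈ _ ty (subst (λ k → Twin k x) (≡.sym (next⁵ i)) tx)))
                         (≡.sym (pentagon-next⁴ i))

    blowup : Blowup (λ x → S x × ¬ Full x)
    blowup = record
      { class = class ; class-adj = λ (x∈ , ¬fx) (y∈ , ¬fy) → class-adj x∈ y∈ ¬fx ¬fy ; rep = c
      ; rep∈ = λ i → c∈ i , λ full → clash (full i) ≁-refl ; rep-class = rep-class }
      where
      class : V → Maybe (Fin 5)
      class x with twin? x
      ... | yes (i , _) = just i
      ... | no _        = nothing

      isolated : ∀ {x} → S x → ¬ Full x → ¬ (∃ λ i → Twin i x) → ∀ i → x ≁ c i
      isolated x∈ ¬full ¬twin with twin⊎isolated x∈ ¬full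
      ... | inj₁ twin = ⊥-elim (¬twin twin)
      ... | inj₂ iso  = iso

      class-adj : ∀ {x y} → S x → S y → ¬ Full x → ¬ Full y →
                  Adj G x y ≡ pentagon+1 (class x) (class y)
      class-adj {x} {y} x∈ y∈ ¬fx ¬fy with twin? x | twin? y
      ... | yes (i , tx) | yes (j , ty) = twins-adj x∈ y∈ i j tx ty
      ... | yes (i , tx) | no ¬ty = ≁-sym (isolated-twin y∈ x∈ (isolated y∈ ¬fy ¬ty) i tx)
      ... | no ¬tx | yes (j , ty) = isolated-twin x∈ y∈ (isolated x∈ ¬fx ¬tx) j ty
      ... | no ¬tx | no ¬ty = isolated-isolated x∈ y∈ (isolated x∈ ¬fx ¬tx) (isolated y∈ ¬fy ¬ty)

      rep-class : ∀ i → class (c i) ≡ just i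
      rep-class i with twin? (c i)
      ... | yes (j , t) = cong just (≡.sym (pentagon-rows i j λ k → trans (≡.sym (c-adj i k)) (t k)))
      ... | no ¬t = ⊥-elim (¬t (i , c-adj i))

  -- Colouring 2K₂-free graphs

  Colourable-cosimplicial : ∀ {S v k} → Independent (NonNbrs S v) →
                            Colourable (Nbrs S v) k → Decidable S → Colourable S (suc k)
  Colourable-cosimplicial {S} {v} I C S? =
    Colourable-∪ (NonNbrs? S? v)
      (λ w∈ w∉ → w∈ , ¬≁⇒~ λ vw → w∉ (w∈ , vw)) (Colourable-independent I) C

  -- A cosimplicial vertex costs one colour and lowers the clique bound by one; a pentagon costs
  -- three colours and lowers it by two.
  Colourable-2K₂-free : HouseFree → ∀ m {S} → Decidable S → ¬ Matching 2 S → ω≤ S m →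
                        Colourable S (threeHalves m)
  Colourable-2K₂-free houseFree zero S? ¬2K₂ ω = Colourable-empty (ω≤0⇒empty ω)
  Colourable-2K₂-free houseFree (suc m) {S} S? ¬2K₂ ω with cosimplicial⊎pentagon houseFree S? ¬2K₂
  ... | inj₁ ∅ = Colourable-empty ∅
  ... | inj₂ (inj₁ (v , v∈ , I)) =
    Colourable-mono (λ x∈ → x∈) (threeHalves-suc m)
      (Colourable-cosimplicial I
        (Colourable-2K₂-free houseFree m (Nbrs? S? v) (¬2K₂ ∘ Matching-mono 2 proj₁) (ω≤-Nbrs v∈ ω)) S?)
  Colourable-2K₂-free houseFree 1 {S} S? ¬2K₂ ω | inj₂ (inj₂ _) =
    Colourable-independent (ω≤1⇒independent ω)
  Colourable-2K₂-free houseFree (suc (suc m)) {S} S? ¬2K₂ ω | inj₂ (inj₂ C) =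
    Colourable-∪ (λ x → S? x ×-dec ¬? (Full? x)) (λ {x} x∈ ¬A → x∈ , full x∈ ¬A)
      (Colourable-blowup blowup)
      (Colourable-2K₂-free houseFree m (λ x → S? x ×-dec Full? x) (¬2K₂ ∘ Matching-mono 2 proj₁)
        -- A clique complete to the pentagon extends by its edge from `c 0F` to `c 1F`.
        (ω≤-mono (λ (x∈ , x~) → (x∈ , ~-sym (x~ 0F)) , ~-sym (x~ 1F))
          (ω≤-Nbrs (c∈ 1F , c~next 0F) (ω≤-Nbrs (c∈ 0F) ω))))
    where
    open Pentagon C
    open AroundPentagon houseFree ¬2K₂ C
    full : ∀ {x} → S x → ¬ (S x × ¬ Full x) → Full x
    full {x} x∈ ¬A with Full? x
    ... | yes p = p
    ... | no ¬p = ⊥-elim (¬A (x∈ , ¬p))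

  -- Triangle-free graphs without 3K₂

  matching₃ : ∀ {S a b c d e f} → S a → S b → S c → S d → S e → S f → a ~ b → c ~ d → e ~ f →
              a ≁ c → a ≁ d → b ≁ c → b ≁ d → a ≁ e → a ≁ f → b ≁ e → b ≁ f →
              c ≁ e → c ≁ f → d ≁ e → d ≁ f → Matching 3 S
  matching₃ a∈ b∈ c∈ d∈ e∈ f∈ ab cd ef ac ad bc bd ae af be bf ce cf de df =
    _ , _ , a∈ , b∈ , ab ,
    matching₂ (c∈ , ac , bc) (d∈ , ad , bd) (e∈ , ae , be) (f∈ , af , bf) cd ef ce cf de df

  -- A vertex complete to a pentagon would form triangles with its edges, so here the blow-up is all
  -- of `S`.
  bipartite⊎blowup : HouseFree → ∀ {S} → Decidable S → ¬ Matching 2 S → ω≤ S 2 →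
                     Colourable S 2 ⊎ Blowup S
  bipartite⊎blowup houseFree {S} S? ¬2K₂ ω with cosimplicial⊎pentagon houseFree S? ¬2K₂
  ... | inj₁ ∅ = inj₁ (Colourable-empty ∅)
  ... | inj₂ (inj₁ (v , v∈ , I)) =
    inj₁ (Colourable-cosimplicial I (Colourable-independent (ω≤1⇒independent (ω≤-Nbrs v∈ ω))) S?)
  ... | inj₂ (inj₂ C) = inj₂ record
    { class = B.class ; class-adj = λ x∈ y∈ → B.class-adj (x∈ , ¬full x∈) (y∈ , ¬full y∈)
    ; rep = c ; rep∈ = c∈ ; rep-class = B.rep-class }
    where
    open Pentagon C
    open AroundPentagon houseFree ¬2K₂ C
    module B = Blowup blowup
    ¬full : ∀ {x} → S x → ¬ Full x
    ¬full x∈ full =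
      clash (c~next 0F) (ω≤2⇒triangleFree ω x∈ (c∈ 0F) (c∈ 1F) (full 0F) (full 1F))

  -- In a triangle-free set the neighbourhoods of `u` and `v` are independent and take one colour
  -- each.
  Colourable-Away : ∀ {S u v k} → Decidable S → ω≤ S 2 → S u → S v →
                    Colourable (Away S u v) k → Colourable S (2 + k)
  Colourable-Away {S} {u} {v} S? ω u∈ v∈ C =
    Colourable-∪ (Nbrs? S? u) (λ w∈ w∉ → w∈ , ¬~⇒≁ λ uw → w∉ (w∈ , uw)) (nbrs u∈)
      (Colourable-∪ (Nbrs? S? v) (λ (w∈ , uw) w∉ → w∈ , uw , ¬~⇒≁ λ vw → w∉ (w∈ , vw)) (nbrs v∈) C)
    where
    nbrs : ∀ {w} → S w → Colourable (Nbrs S w) 1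
    nbrs w∈ = Colourable-independent (ω≤1⇒independent (ω≤-Nbrs w∈ ω))

  module FourColours {S : VertexSet} (S? : Decidable S) (¬3K₂ : ¬ Matching 3 S) (ω : ω≤ S 2)
                     (blow : ∀ {p q} → S p → S q → p ~ q → Blowup (Away S p q))
                     {u v : V} (u∈ : S u) (v∈ : S v) (uv : u ~ v) where

    open Blowup (blow u∈ v∈ uv)

    triangleFree : ∀ {x y z} → S x → S y → S z → x ~ y → x ~ z → y ≁ z
    triangleFree = ω≤2⇒triangleFree ω

    -- The classes `A i`, the isolated vertices `Z` and the neighbours `X` of `u` together make up
    -- the part of `S` outside N(v).
    A : Fin 5 → VertexSet
    A i w = Away S u v w × class w ≡ just i

    Z X : VertexSet
    Z w = Away S u v w × class w ≡ nothing
    X w = S w × u ~ w × v ≁ w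

    A? : ∀ i → Decidable (A i)
    A? i w = Away? S? u v w ×-dec ≡-dec _≟ᶠ_ (class w) (just i)

    Z? : Decidable Z
    Z? w = Away? S? u v w ×-dec ≡-dec _≟ᶠ_ (class w) nothing

    X? : Decidable X
    X? w = S? w ×-dec ((u ~? w) ×-dec (Adj G v w Bool.≟ false))

    A⇒S : ∀ {i a} → A i a → S a
    A⇒S ((a∈ , _) , _) = a∈

    Z⇒S : ∀ {z} → Z z → S z
    Z⇒S ((z∈ , _) , _) = z∈

    A-adj : ∀ {i j a b} → A i a → A j b → Adj G a b ≡ pentagon i j
    A-adj (a∈ , a≡) (b∈ , b≡) with class-adj a∈ b∈
    ... | adj rewrite a≡ | b≡ = adj

    A~next : ∀ {i a b} → A i a → A (next i) b → a ~ b
    A~next a∈ b∈ = trans (A-adj a∈ b∈) (pentagon-next _)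

    A≁next² : ∀ {i a b} → A i a → A (next (next i)) b → a ≁ b
    A≁next² a∈ b∈ = trans (A-adj a∈ b∈) (pentagon-next² _)

    Z≁A : ∀ {i z a} → Z z → A i a → z ≁ a
    Z≁A (z∈ , z≡) (a∈ , a≡) with class-adj z∈ a∈
    ... | adj rewrite z≡ = adj

    Z≁Z : ∀ {z z′} → Z z → Z z′ → z ≁ z′
    Z≁Z (z∈ , z≡) (z∈′ , _) with class-adj z∈ z∈′
    ... | adj rewrite z≡ = adj

    Meets Avoids : Fin 5 → VertexSet
    Meets i x = ∃ λ a → A i a × x ~ a
    Avoids i x = ∀ {a} → A i a → x ≁ a

    meets⊎avoids : ∀ i x → Meets i x ⊎ Avoids i x
    meets⊎avoids i x with any? (λ a → A? i a ×-dec (x ~? a))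
    ... | yes found = inj₁ found
    ... | no none   = inj₂ λ a∈ → ¬~⇒≁ λ xa → none (_ , a∈ , xa)

    -- Consecutive classes are complete to each other, so meeting both would close a triangle.
    meets⇒avoids-next : ∀ {i x} → S x → Meets i x → Avoids (next i) x
    meets⇒avoids-next x∈ (a , a∈ , xa) b∈ =
      ≁-sym (triangleFree (A⇒S a∈) (A⇒S b∈) x∈ (A~next a∈ b∈) (~-sym xa))

    meets-next⇒avoids : ∀ {i x} → S x → Meets (next i) x → Avoids i x
    meets-next⇒avoids x∈ (a , a∈ , xa) b∈ =
      ≁-sym (triangleFree (A⇒S a∈) (A⇒S b∈) x∈ (~-sym (A~next b∈ a∈)) (~-sym xa))

    meets⇒¬avoids : ∀ {i x} → Meets i x → ¬ Avoids i x
    meets⇒¬avoids (a , a∈ , xa) av = clash xa (av a∈)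

    module Rotation (r : Fin 5) where

      -- On the pentagon, colour 0 sits at r + 1 and r + 3, colour 1 at r + 2 and r + 4, colour 2 at
      -- `r`. Tint 2 records meeting the classes r + 1 and r + 4: within `S` this forces avoiding
      -- class `r`, and it is what the obstruction needs.
      data Tint (x : V) : ℕ → Set where
        tint₀ : Avoids (next r) x → Avoids (next (next (next r))) x → Tint x 0
        tint₁ : Avoids (next (next r)) x → Avoids (next (next (next (next r)))) x → Tint x 1
        tint₂ : Meets (next r) x → Meets (next (next (next (next r)))) x → Tint x 2

      -- If tints 0 and 1 fail, `x` meets one of the classes r + 1, r + 3 and one of r + 2, r + 4;
      -- as consecutive classes exclude each other, these are r + 1 and r + 4.
      tinted : ∀ x → ∃ λ k → k < 3 × (X x → Tint x k)
      tinted x with meets⊎avoids (next r) x | meets⊎avoids (next (next r)) x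
                  | meets⊎avoids (next (next (next r))) x
                  | meets⊎avoids (next (next (next (next r)))) x
      ... | inj₂ a₁ | _       | inj₂ a₃ | _       = 0 , s≤s z≤n , λ _ → tint₀ a₁ a₃
      ... | _       | inj₂ a₂ | _       | inj₂ a₄ = 1 , s≤s (s≤s z≤n) , λ _ → tint₁ a₂ a₄
      ... | inj₁ m₁ | _       | _       | inj₁ m₄ = 2 , ≤-refl , λ _ → tint₂ m₁ m₄
      -- In the remaining cases `x` meets two consecutive classes, which contradicts `X x`; the
      -- colour 0 is a placeholder.
      ... | _       | inj₁ m₂ | inj₁ m₃ | _       =
        0 , s≤s z≤n , λ (x∈ , _) → ⊥-elim (meets⇒¬avoids m₃ (meets⇒avoids-next x∈ m₂))
      ... | inj₁ m₁ | inj₁ m₂ | _ | _ =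
        0 , s≤s z≤n , λ (x∈ , _) → ⊥-elim (meets⇒¬avoids m₂ (meets⇒avoids-next x∈ m₁))
      ... | _ | _ | inj₁ m₃ | inj₁ m₄ =
        0 , s≤s z≤n , λ (x∈ , _) → ⊥-elim (meets⇒¬avoids m₄ (meets⇒avoids-next x∈ m₃))

      tint : V → ℕ
      tint x = proj₁ (tinted x)

      tint-A : ∀ {i x a} → X x → A i a → x ~ a → tint x ≢ pentagonColour r i
      tint-A {i} {x} x∈ a∈ xa with tint x | proj₂ (proj₂ (tinted x)) x∈ | offset r i
      ... | _ | tint₀ a₁ a₃ | ahead   = λ _ → clash xa (a₁ a∈)
      ... | _ | tint₀ a₁ a₃ | behind² = λ _ → clash xa (a₃ a∈)
      ... | _ | tint₀ _ _   | same    = λ ()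
      ... | _ | tint₀ _ _   | ahead²  = λ ()
      ... | _ | tint₀ _ _   | behind  = λ ()
      ... | _ | tint₁ a₂ a₄ | ahead²  = λ _ → clash xa (a₂ a∈)
      ... | _ | tint₁ a₂ a₄ | behind  = λ _ → clash xa (a₄ a∈)
      ... | _ | tint₁ _ _   | same    = λ ()
      ... | _ | tint₁ _ _   | ahead   = λ ()
      ... | _ | tint₁ _ _   | behind² = λ ()
      ... | _ | tint₂ m₁ _  | same    = λ _ → clash xa (meets-next⇒avoids (proj₁ x∈) m₁ a∈)
      ... | _ | tint₂ _ _   | ahead   = λ ()
      ... | _ | tint₂ _ _   | ahead²  = λ ()
      ... | _ | tint₂ _ _   | behind² = λ ()
      ... | _ | tint₂ _ _   | behind  = λ ()

      Seen : V → ℕ → Set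
      Seen z k = ∃ λ x → X x × z ~ x × tint x ≡ k

      Seen? : ∀ z k → Dec (Seen z k)
      Seen? z k = any? λ x → X? x ×-dec ((z ~? x) ×-dec (tint x ℕₚ.≟ k))

      Stuck : VertexSet
      Stuck z = Z z × Seen z 0 × Seen z 1 × Seen z 2

      stuck⊎free : ∀ z → Stuck z ⊎ (∃ λ k → k < 3 × (Z z → ¬ Seen z k))
      stuck⊎free z with Z? z | Seen? z 0 | Seen? z 1 | Seen? z 2
      ... | no z∉  | _      | _      | _      = inj₂ (0 , s≤s z≤n , λ z∈ → ⊥-elim (z∉ z∈))
      ... | yes _  | no s₀  | _      | _      = inj₂ (0 , s≤s z≤n , λ _ → s₀)
      ... | yes _  | yes _  | no s₁  | _      = inj₂ (1 , s≤s (s≤s z≤n) , λ _ → s₁)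
      ... | yes _  | yes _  | yes _  | no s₂  = inj₂ (2 , ≤-refl , λ _ → s₂)
      ... | yes z∈ | yes s₀ | yes s₁ | yes s₂ = inj₁ (z∈ , s₀ , s₁ , s₂)

      module _ (free : ∀ z → ∃ λ k → k < 3 × (Z z → ¬ Seen z k)) where

        data Kind (w : V) : ℕ → Set where
          inX : X w → Kind w (tint w)
          inA : ∀ {i} → A i w → Kind w (pentagonColour r i)
          inZ : Z w → Kind w (proj₁ (free w))

        kind : ∀ w → ∃ λ k → k < 3 × (NonNbrs S v w → Kind w k)
        kind w with ~⊎≁ u w | class w in eq
        ... | inj₁ uw | _       = tint w , proj₁ (proj₂ (tinted w)) , λ (w∈ , vw) → inX (w∈ , uw , vw)
        ... | inj₂ uw | just i  = _ , pentagonColour<3 r i , λ (w∈ , vw) → inA ((w∈ , uw , vw) , eq)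
        ... | inj₂ uw | nothing =
          _ , proj₁ (proj₂ (free w)) , λ (w∈ , vw) → inZ ((w∈ , uw , vw) , eq)

        kinds-proper : ∀ {x y k l} → Kind x k → Kind y l → x ~ y → k ≢ l
        kinds-proper (inX (x∈ , ux , _)) (inX (y∈ , uy , _)) xy =
          λ _ → clash xy (triangleFree u∈ x∈ y∈ ux uy)
        kinds-proper (inX x∈) (inA y∈) xy = tint-A x∈ y∈ xy
        kinds-proper {x} {y} (inX x∈) (inZ y∈) xy =
          λ eq → proj₂ (proj₂ (free y)) y∈ (x , x∈ , ~-sym xy , eq)
        kinds-proper (inA x∈) (inX y∈) xy = tint-A y∈ x∈ (~-sym xy) ∘ ≡.sym
        kinds-proper (inA x∈) (inA y∈) xy =
          pentagonColour-proper r _ _ (trans (≡.sym (A-adj x∈ y∈)) xy)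
        kinds-proper (inA x∈) (inZ y∈) xy = λ _ → clash (~-sym xy) (Z≁A y∈ x∈)
        kinds-proper {x} {y} (inZ x∈) (inX y∈) xy =
          λ eq → proj₂ (proj₂ (free x)) x∈ (y , y∈ , xy , ≡.sym eq)
        kinds-proper (inZ x∈) (inA y∈) xy = λ _ → clash xy (Z≁A x∈ y∈)
        kinds-proper (inZ x∈) (inZ y∈) xy = λ _ → clash xy (Z≁Z x∈ y∈)

        free⇒4-colourable : Colourable S 4
        free⇒4-colourable =
          Colourable-∪ (Nbrs? S? v) (λ w∈ w∉ → w∈ , ¬~⇒≁ λ vw → w∉ (w∈ , vw))
            (Colourable-independent (ω≤1⇒independent (ω≤-Nbrs v∈ ω)))
            (record
              { colour = λ w → proj₁ (kind w)
              ; bound  = λ {w} _ → proj₁ (proj₂ (kind w))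
              ; proper = λ {x} {y} x∈ y∈ →
                  kinds-proper (proj₂ (proj₂ (kind x)) x∈) (proj₂ (proj₂ (kind y)) y∈) })

    -- A stuck vertex `z` with neighbours `a`, `b` and `x` of tints 0, 1 and 2, stated through the
    -- classes they avoid or meet.
    record Obstruction (r : Fin 5) : Set where
      field
        {z x a b} : V
        z∈        : Z z
        x∈        : X x
        a∈        : X a
        b∈        : X b
        zx        : z ~ x
        za        : z ~ a
        zb        : z ~ b
        x-hi      : Meets (next r) x
        x-lo      : Meets (next (next (next (next r)))) x
        a-avoids₁ : Avoids (next r) a
        a-avoids₃ : Avoids (next (next (next r))) a
        b-avoids₂ : Avoids (next (next r)) b
        b-avoids₄ : Avoids (next (next (next (next r)))) b

    4-colourable⊎obstruction : ∀ r → Colourable S 4 ⊎ Obstruction r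
    4-colourable⊎obstruction r with search stuck⊎free
      where open Rotation r
    ... | inj₂ free = inj₁ (Rotation.free⇒4-colourable r free)
    ... | inj₁ (z , z∈ , (a , a∈ , za , a≡) , (b , b∈ , zb , b≡) , (x , x∈ , zx , x≡))
      with Rotation.tint r a | proj₂ (proj₂ (Rotation.tinted r a)) a∈ | a≡
         | Rotation.tint r b | proj₂ (proj₂ (Rotation.tinted r b)) b∈ | b≡
         | Rotation.tint r x | proj₂ (proj₂ (Rotation.tinted r x)) x∈ | x≡
    ... | _ | Rotation.tint₀ a₁ a₃ | refl | _ | Rotation.tint₁ b₂ b₄ | refl
        | _ | Rotation.tint₂ x₁ x₄ | refl = inj₂ record
      { z∈ = z∈ ; x∈ = x∈ ; a∈ = a∈ ; b∈ = b∈ ; zx = zx ; za = za ; zb = zb ; x-hi = x₁ ; x-lo = x₄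
      ; a-avoids₁ = a₁ ; a-avoids₃ = a₃ ; b-avoids₂ = b₂ ; b-avoids₄ = b₄ }

    -- Combining the five failed rotations

    module Obstructed (obstruction : ∀ r → Obstruction r) where
      module O r = Obstruction (obstruction r)

      -- `lo r` and `hi r` are neighbours of `x r` in the classes r - 1 and r + 1.
      x z lo hi : Fin 5 → V
      x r = O.x r
      z r = O.z r
      lo r = proj₁ (O.x-lo r)
      hi r = proj₁ (O.x-hi r)

      x∈ : ∀ i → S (x i)
      x∈ i = proj₁ (O.x∈ i)

      ux : ∀ i → u ~ x i
      ux i = proj₁ (proj₂ (O.x∈ i))

      vx : ∀ i → v ≁ x i
      vx i = proj₂ (proj₂ (O.x∈ i))

      lo∈ : ∀ i → A (next (next (next (next i)))) (lo i)
      lo∈ i = proj₁ (proj₂ (O.x-lo i))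

      hi∈ : ∀ i → A (next i) (hi i)
      hi∈ i = proj₁ (proj₂ (O.x-hi i))

      x~lo : ∀ i → x i ~ lo i
      x~lo i = proj₂ (proj₂ (O.x-lo i))

      x~hi : ∀ i → x i ~ hi i
      x~hi i = proj₂ (proj₂ (O.x-hi i))

      x≁x : ∀ i j → x i ≁ x j
      x≁x i j = triangleFree u∈ (x∈ i) (x∈ j) (ux i) (ux j)

      v≁A : ∀ {i a} → A i a → v ≁ a
      v≁A ((_ , _ , va) , _) = va

      u≁A : ∀ {i a} → A i a → u ≁ a
      u≁A ((_ , ua , _) , _) = ua

      x-avoids₂ : ∀ i → Avoids (next (next i)) (x i)
      x-avoids₂ i = meets⇒avoids-next (x∈ i) (O.x-hi i)

      x-avoids₃ : ∀ i → Avoids (next (next (next i))) (x i)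
      x-avoids₃ i = meets-next⇒avoids (x∈ i) (O.x-lo i)

      -- z′ and z i both have neighbours in the blow-up Away S p q, which contains u and v, and both
      -- miss u and v: they lie in its class opposite to the edge uv.
      module _ {w z′ p q : V} (i : Fin 5) (z∈ : Z z′) (w∈ : S w) (zw : z′ ~ w)
               (p∈ : A (next (next i)) p) (q∈ : A (next (next (next i))) q)
               (pw : p ≁ w) (qw : q ≁ w) where

        private
          module B = Blowup (blow (A⇒S p∈) (A⇒S q∈) (A~next p∈ q∈))

          away : ∀ {y} → Z y → Away S p q y
          away y∈ = Z⇒S y∈ , ≁-sym (Z≁A y∈ p∈) , ≁-sym (Z≁A y∈ q∈)

          u-away : Away S p q u
          u-away = u∈ , ≁-sym (u≁A p∈) , ≁-sym (u≁A q∈)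

          v-away : Away S p q v
          v-away = v∈ , ≁-sym (v≁A p∈) , ≁-sym (v≁A q∈)

          x-away : Away S p q (x i)
          x-away = x∈ i , ≁-sym (x-avoids₂ i p∈) , ≁-sym (x-avoids₃ i q∈)

          Z≁u : ∀ {y} → Z y → y ≁ u
          Z≁u ((_ , uy , _) , _) = ≁-sym uy

          Z≁v : ∀ {y} → Z y → y ≁ v
          Z≁v ((_ , _ , vy) , _) = ≁-sym vy

        sees-x : z′ ~ x i
        sees-x
          with B.class u | B.class v | B.class z′ | B.class (z i) | B.class w | B.class (x i)
             | trans (≡.sym (B.class-adj u-away v-away)) uv
             | trans (≡.sym (B.class-adj (away z∈) u-away)) (Z≁u z∈)
             | trans (≡.sym (B.class-adj (away z∈) v-away)) (Z≁v z∈)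
             | trans (≡.sym (B.class-adj (away (O.z∈ i)) u-away)) (Z≁u (O.z∈ i))
             | trans (≡.sym (B.class-adj (away (O.z∈ i)) v-away)) (Z≁v (O.z∈ i))
             | trans (≡.sym (B.class-adj (away z∈) (w∈ , pw , qw))) zw
             | trans (≡.sym (B.class-adj (away (O.z∈ i)) x-away)) (O.zx i)
             | B.class-adj (away z∈) x-away
        -- All six vertices have an edge inside this blow-up (uv, z′ to `w`, `z i` to `x i`), so
        -- none is isolated.
        ... | just α | just β | just γ | just δ | just _ | just ξ | αβ | γα | γβ | δα | δβ | _ | δξ | zx
          rewrite opposite-unique α β γ δ αβ γα γβ δα δβ = trans zx δξ

        -- The class of z′ is opposite to the edge uv, hence at distance two from that of `v`; `y`
        -- represents the class between them.
        common : ∃ λ y → Away S p q y × v ~ y × z′ ~ y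
        common
          with B.class u in u≡ | B.class v in v≡ | B.class z′ in z≡ | B.class w
             | trans (≡.sym (B.class-adj u-away v-away)) uv
             | trans (≡.sym (B.class-adj (away z∈) u-away)) (Z≁u z∈)
             | trans (≡.sym (B.class-adj (away z∈) v-away)) (Z≁v z∈)
             | trans (≡.sym (B.class-adj (away z∈) (w∈ , pw , qw))) zw
        ... | just α | just β | just γ | just _ | αβ | γα | γβ | _
          with opposite-common α β γ αβ γα γβ
        ... | k , βk , γk = B.rep k , B.rep∈ k ,
          trans (B.class-adj v-away (B.rep∈ k))
            (trans (≡.cong₂ pentagon+1 v≡ (B.rep-class k)) βk) ,
          trans (B.class-adj (away z∈) (B.rep∈ k))
            (trans (≡.cong₂ pentagon+1 z≡ (B.rep-class k)) γk)

      -- Let `y` be the common neighbour of `v` and z′. It sees `lo r`, or else `x r` with `lo r`, x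
      -- with hi at r + 1, and `v` with `y` form an induced 3K₂. Hence it misses class `r`, and x
      -- with lo at r + 1, x with hi at r + 2, and `v` with `y` form one.
      ¬consecutive : ∀ {z′} r → Z z′ → z′ ~ x r → z′ ~ x (next r) → z′ ~ x (next (next r)) → ⊥
      ¬consecutive r z∈ z₀ z₁ z₂
        with common r z∈ (x∈ r) z₀ (hi∈ (next r)) (hi∈ (next (next r)))
                    (≁-sym (x-avoids₂ r (hi∈ _))) (≁-sym (x-avoids₃ r (hi∈ _)))
      ... | y , (y∈ , hi₁y , hi₂y) , vy , zy = ¬3K₂ (matching₃
          (x∈ _) (A⇒S (lo∈ _)) (x∈ _) (A⇒S (hi∈ _)) v∈ y∈ (x~lo (next r)) (x~hi (next (next r))) vy
          (x≁x _ _) (x-avoids₂ _ (hi∈ _)) (≁-sym (x-avoids₃ _ (lo∈ (next r)))) (≁-sym (A≁next² (hi∈ _) (lo∈ _)))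
          (≁-sym (vx _)) (xy z₁) (≁-sym (v≁A (lo∈ _))) (≁-sym (y≁ (lo∈ _)))
          (≁-sym (vx _)) (xy z₂) (≁-sym (v≁A (hi∈ _))) hi₂y)
        where
        xy : ∀ {i} → _ ~ x i → x i ≁ y
        xy zx = triangleFree (Z⇒S z∈) (x∈ _) y∈ zx zy
        y~lo : y ~ lo r
        y~lo = ¬≁⇒~ λ q → ¬3K₂ (matching₃
          (x∈ _) (A⇒S (lo∈ _)) (x∈ _) (A⇒S (hi∈ _)) v∈ y∈ (x~lo r) (x~hi (next r)) vy
          (x≁x _ _) (x-avoids₂ _ (hi∈ _)) (≁-sym (x-avoids₃ _ (lo∈ _))) (≁-sym (A≁next² (hi∈ _) (lo∈ _)))
          (≁-sym (vx _)) (xy z₀) (≁-sym (v≁A (lo∈ _))) (≁-sym q)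
          (≁-sym (vx _)) (xy z₁) (≁-sym (v≁A (hi∈ _))) hi₁y)
        y≁ : Avoids (next (next (next (next (next r))))) y
        y≁ = meets⇒avoids-next y∈ (_ , lo∈ r , y~lo)

      sees-x-avoiding : ∀ {w} i → X w → z 0F ~ w →
        Avoids (next (next i)) w → Avoids (next (next (next i))) w → z 0F ~ x i
      sees-x-avoiding i (w∈ , _) zw av₂ av₃ =
        sees-x i (O.z∈ 0F) w∈ zw (hi∈ (next i)) (hi∈ (next (next i)))
               (≁-sym (av₂ (hi∈ _))) (≁-sym (av₃ (hi∈ _)))

      -- The neighbour `a` of `z 0F` avoids classes 1 and 3. If it meets class 4 it avoids class 0,
      -- and the pair 0, 1 leads to `x 3F`; otherwise the pair 3, 4 leads to `x 1F`.
      sees₁⊎₃ : z 0F ~ x 1F ⊎ z 0F ~ x 3F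
      sees₁⊎₃ with meets⊎avoids 4F (O.a 0F)
      ... | inj₁ m = inj₂ (sees-x-avoiding 3F (O.a∈ 0F) (O.za 0F)
                             (meets⇒avoids-next (proj₁ (O.a∈ 0F)) m) (O.a-avoids₁ 0F))
      ... | inj₂ a = inj₁ (sees-x-avoiding 1F (O.a∈ 0F) (O.za 0F) (O.a-avoids₃ 0F) a)

      sees₂⊎₄ : z 0F ~ x 2F ⊎ z 0F ~ x 4F
      sees₂⊎₄ with meets⊎avoids 1F (O.b 0F)
      ... | inj₁ m = inj₁ (sees-x-avoiding 2F (O.b∈ 0F) (O.zb 0F)
                             (O.b-avoids₄ 0F) (meets-next⇒avoids (proj₁ (O.b∈ 0F)) m))
      ... | inj₂ a = inj₂ (sees-x-avoiding 4F (O.b∈ 0F) (O.zb 0F) a (O.b-avoids₂ 0F))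

      z₀∈ : Z (z 0F)
      z₀∈ = O.z∈ 0F

      z₀x₀ : z 0F ~ x 0F
      z₀x₀ = O.zx 0F

      -- Either alternative of `sees₂⊎₄` would complete three cyclically consecutive neighbours.
      z₀≁x₁ : ¬ z 0F ~ x 1F
      z₀≁x₁ z₁ with sees₂⊎₄
      ... | inj₁ z₂ = ¬consecutive 0F z₀∈ z₀x₀ z₁ z₂
      ... | inj₂ z₄ = ¬consecutive 4F z₀∈ z₄ z₀x₀ z₁

      z₀x₃ : z 0F ~ x 3F
      z₀x₃ = [ ⊥-elim ∘ z₀≁x₁ , (λ p → p) ]′ sees₁⊎₃

      z₀x₂ : z 0F ~ x 2F
      z₀x₂ = [ (λ p → p) , ⊥-elim ∘ (λ z₄ → ¬consecutive 3F z₀∈ z₀x₃ z₄ z₀x₀) ]′ sees₂⊎₄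

      -- The common neighbour `y` sees `lo 4F`, since otherwise `sees-x` would give the excluded
      -- edge to `x 1F`. Then `y` misses `x 4F` and class 2, and the edges from `x 3F` to `lo 3F`,
      -- `x 4F` to `hi 4F` and `v` to `y` form an induced 3K₂.
      impossible : ⊥
      impossible
        with common 2F z₀∈ (x∈ 2F) z₀x₂ (hi∈ 3F) (hi∈ 4F)
                    (≁-sym (x-avoids₂ 2F (hi∈ 3F))) (≁-sym (x-avoids₃ 2F (hi∈ 4F)))
      ... | y , (y∈ , hi₃y , hi₄y) , vy , zy = ¬3K₂ (matching₃
          (x∈ 3F) (A⇒S (lo∈ 3F)) (x∈ 4F) (A⇒S (hi∈ 4F)) v∈ y∈ (x~lo 3F) (x~hi 4F) vy
          (x≁x _ _) (x-avoids₂ 3F (hi∈ 4F)) (≁-sym (x-avoids₃ 4F (lo∈ 3F))) (≁-sym (A≁next² (hi∈ 4F) (lo∈ 3F)))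
          (≁-sym (vx 3F)) (triangleFree (Z⇒S z₀∈) (x∈ 3F) y∈ z₀x₃ zy)
          (≁-sym (v≁A (lo∈ 3F))) (≁-sym (meets-next⇒avoids y∈ (lo 4F , lo∈ 4F , y~lo₄) (lo∈ 3F)))
          (≁-sym (vx 4F)) (triangleFree (A⇒S (lo∈ 4F)) (x∈ 4F) y∈ (~-sym (x~lo 4F)) (~-sym y~lo₄))
          (≁-sym (v≁A (hi∈ 4F))) hi₄y)
        where
        y~lo₄ : y ~ lo 4F
        y~lo₄ = ¬≁⇒~ λ q → z₀≁x₁ (sees-x 1F z₀∈ y∈ zy (lo∈ 4F) (hi∈ 3F) (≁-sym q) hi₃y)

  4-colourable : HouseFree → ∀ {S} → Decidable S → ¬ Matching 3 S → ω≤ S 2 → Colourable S 4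
  4-colourable houseFree {S} S? ¬3K₂ ω with edge⊎independent S?
  ... | inj₂ I = Colourable-mono (λ x∈ → x∈) (s≤s z≤n) (Colourable-independent I)
  ... | inj₁ (u , v , u∈ , v∈ , uv) with search (λ p → search (λ q → edge p q))
    where
    Bip Blow : V → V → Set
    Bip p q = S p × S q × Colourable (Away S p q) 2
    Blow p q = S p → S q → p ~ q → Blowup (Away S p q)
    edge : ∀ p q → Bip p q ⊎ Blow p q
    edge p q with S? p | S? q | p ~? q
    ... | no p∉ | _ | _ = inj₂ λ p∈ → ⊥-elim (p∉ p∈)
    ... | yes _ | no q∉ | _ = inj₂ λ _ q∈ → ⊥-elim (q∉ q∈)
    ... | yes _ | yes _ | no ¬pq = inj₂ λ _ _ pq → ⊥-elim (¬pq pq)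
    ... | yes p∈ | yes q∈ | yes pq
      with bipartite⊎blowup houseFree (Away? S? p q) (λ M → ¬3K₂ (_ , _ , p∈ , q∈ , pq , M)) (ω≤-mono proj₁ ω)
    ...   | inj₁ C = inj₁ (p∈ , q∈ , C)
    ...   | inj₂ B = inj₂ λ _ _ _ → B
  ... | inj₁ (p , q , p∈ , q∈ , C) = Colourable-Away S? ω p∈ q∈ C
  ... | inj₂ blow with search (FourColours.4-colourable⊎obstruction S? ¬3K₂ ω (λ {p} {q} → blow p q) u∈ v∈ uv)
  ...   | inj₁ (_ , C) = C
  ...   | inj₂ obstruction =
    ⊥-elim (FourColours.Obstructed.impossible S? ¬3K₂ ω (λ {p} {q} → blow p q) u∈ v∈ uv obstruction)

  -- Colouring around a maximum clique

  hit : List V → V → List V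
  hit P w = filter (w ~?_) P

  nonadjacent? : ∀ w → Decidable (w ≁_)
  nonadjacent? w q = Adj G w q Bool.≟ false

  opaque
    missed : List V → V → List V
    missed P w = filter (nonadjacent? w) P

    missed-[] : ∀ {w} → missed [] w ≡ []
    missed-[] = refl

    missed-~ : ∀ {w v} P → w ~ v → missed (v ∷ P) w ≡ missed P w
    missed-~ {w} P wv = filter-reject (nonadjacent? w) (clash wv)

    missed-≁ : ∀ {w v} P → w ≁ v → missed (v ∷ P) w ≡ v ∷ missed P w
    missed-≁ {w} P wv = filter-accept (nonadjacent? w) wv

    ∈-missed⁺ : ∀ {j P w} → j ∈ P → w ≁ j → j ∈ missed P w
    ∈-missed⁺ {w = w} = ∈-filter⁺ (nonadjacent? w)

    ∈-missed⁻ : ∀ {j P w} → j ∈ missed P w → j ∈ P × w ≁ j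
    ∈-missed⁻ {w = w} = ∈-filter⁻ (nonadjacent? w)

    length-missed-∷ : ∀ v P w → length (missed (v ∷ P) w) ≡ length (missed (v ∷ []) w) + length (missed P w)
    length-missed-∷ v P w =
      trans (cong length (filter-++ (nonadjacent? w) (v ∷ []) P)) (length-++ (missed (v ∷ []) w))

    length-missed-≤ : ∀ P w → length (missed P w) ≤ length P
    length-missed-≤ P w = length-filter (nonadjacent? w) P

    length-missed+hit : ∀ P w → length (missed P w) + length (hit P w) ≡ length P
    length-missed+hit [] w = refl
    length-missed+hit (v ∷ P) w with Adj G w v
    ... | true  = trans (ℕₚ.+-suc _ _) (cong suc (length-missed+hit P w))
    ... | false = cong suc (length-missed+hit P w)

  module _ {P : List V} {w i : V} (missed≡ : missed P w ≡ i ∷ []) where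

    missed⇒∈ : i ∈ P × w ≁ i
    missed⇒∈ = ∈-missed⁻ (subst (i ∈_) (≡.sym missed≡) (here refl))

    others-adjacent : ∀ {j} → j ∈ P → j ≢ i → w ~ j
    others-adjacent j∈ j≢i = ¬≁⇒~ λ wj → only (subst (_ ∈_) missed≡ (∈-missed⁺ j∈ wj))
      where
      only : ¬ _ ∈ (i ∷ [])
      only (here j≡i) = j≢i j≡i

  -- Replacing `i` by `K` in `P` gives a clique of size |K| + |P| - 1.
  fibre-clique : ∀ {S P K m i} → ω≤ S m → Clique S P → Clique S K →
                 All (λ w → missed P w ≡ i ∷ []) K → length K + length P ≤ suc m
  fibre-clique {P = P} ω P-clique _ [] = ℕₚ.m≤n⇒m≤1+n (ω P P-clique)
  fibre-clique {S} {P} {w ∷ K} {m} {i} ω (P∈ , P~) (K∈ , K~) (w≡ ∷ K≡) = begin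
    length (w ∷ K) + length P                    ≡⟨ cong (length (w ∷ K) ℕ.+_) (≡.sym P-length) ⟩
    length (w ∷ K) + suc (length (hit P w))      ≡⟨ ℕₚ.+-suc (length (w ∷ K)) (length (hit P w)) ⟩
    suc (length (w ∷ K) + length (hit P w))      ≡⟨ cong suc (≡.sym (length-++ (w ∷ K))) ⟩
    suc (length ((w ∷ K) ++ hit P w))            ≤⟨ s≤s (ω _ extended) ⟩
    suc m                                        ∎
    where
    open ℕₚ.≤-Reasoning
    P-length : suc (length (hit P w)) ≡ length P
    P-length = trans (cong (λ xs → length xs + length (hit P w)) (≡.sym w≡)) (length-missed+hit P w)
    complete : ∀ {y} → missed P y ≡ i ∷ [] → All (y ~_) (hit P w)
    complete y≡ = All.tabulate λ j∈ → let (j∈P , wj) = ∈-filter⁻ (w ~?_) {xs = P} j∈ in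
      others-adjacent y≡ j∈P λ { refl → clash wj (proj₂ (missed⇒∈ w≡)) }
    extended : Clique S ((w ∷ K) ++ hit P w)
    extended = All.++⁺ K∈ (All.filter⁺ (w ~?_) P∈) ,
      AllPairs.++⁺ K~ (AllPairs.filter⁺ (w ~?_) P~) (All.map complete (w≡ ∷ K≡))

  module AroundClique (houseFree : HouseFree) {S : VertexSet} (S? : Decidable S) {p m : ℕ}
                      (¬M : ¬ Matching (2 + p) S) (ω : ω≤ S m) (g : ℕ → ℕ)
                      (colourable : ∀ t {T} → Decidable T → ¬ Matching (suc p) T → ω≤ T t → Colourable T (g t)) where

    -- P is the scanned part of the clique, L the rest: the second missed vertex lies in L.
    Late : List V → List V → VertexSet
    Late P L w = S w × length (missed P w) ≤ 1 × 2 ≤ length (missed P w) + length (missed L w)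

    Late? : ∀ P L → Decidable (Late P L)
    Late? P L w = S? w ×-dec ((_ ≤? _) ×-dec (_ ≤? _))

    -- `v` is the second clique vertex that `w` misses in the scan order.
    Second : List V → V → VertexSet
    Second P v w = S w × v ≁ w × ∃ λ i → missed P w ≡ i ∷ []

    Late-∷ : ∀ {P v L w} → Late P (v ∷ L) w → ¬ Late (v ∷ P) L w → Second P v w
    Late-∷ {P} {v} {L} {w} (w∈ , ≤1 , 2≤) ¬late with ~⊎≁ w v
    ... | inj₁ wv = ⊥-elim (¬late (w∈ , subst (λ xs → length xs ≤ 1) (≡.sym (missed-~ P wv)) ≤1 ,
      ≡.subst₂ (λ xs ys → 2 ≤ length xs + length ys) (≡.sym (missed-~ P wv)) (missed-~ L wv) 2≤))
    ... | inj₂ wv with missed P w in eq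
    ...   | [] = ⊥-elim (¬late (w∈ , subst (λ xs → length xs ≤ 1) (≡.sym one) ≤-refl ,
      subst (λ xs → 2 ≤ length xs + length (missed L w)) (≡.sym one)
        (subst (λ xs → 2 ≤ length xs) (missed-≁ L wv) 2≤)))
      where
      one : missed (v ∷ P) w ≡ v ∷ []
      one = trans (missed-≁ P wv) (cong (v ∷_) eq)
    ...   | i ∷ [] = w∈ , ≁-sym wv , i , refl
    Late-∷ (_ , s≤s () , _) _ | inj₂ _ | _ ∷ _ ∷ _

    -- Group by the one vertex `i` missed in `P`. Adjacent `x`, `y` missing different `i`, `j` would
    -- form the square i, j, x, y with roof `v`. The edge iv is anticomplete to its group, which
    -- lowers the matching number, and `fibre-clique` bounds the cliques.
    Colourable-Second : ∀ {P v} → Clique S P → S v → All (v ~_) P → ∀ {t} → suc m ≤ t + length P →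
                        Colourable (Second P v) (g t)
    Colourable-Second {P} {v} (P∈ , P~) v∈ vP {t} bound =
      Colourable-fibres (λ w → first w (missed P w)) agree λ i →
        Colourable-mono (λ ((w∈ , vw , j , w≡) , label) → w∈ , vw ,
                          trans w≡ (cong (_∷ []) (trans (≡.sym (cong (first _) w≡)) label))) ≤-refl
          (colourable t (Fibre? i) (fibre-matching i) (fibre-ω i))
      where
      first : V → List V → V
      -- The default makes the label total; on `Second P v` the list has exactly one entry.
      first d []      = d
      first d (x ∷ _) = x

      Fibre : V → VertexSet
      Fibre i w = S w × v ≁ w × missed P w ≡ i ∷ []

      Fibre? : ∀ i → Decidable (Fibre i)
      Fibre? i w = S? w ×-dec ((Adj G v w Bool.≟ false) ×-dec List-≡-dec _≟ᶠ_ _ _)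

      P-adjacent : ∀ {P} → AllPairs _~_ P → ∀ {i j} → i ∈ P → j ∈ P → i ≢ j → i ~ j
      P-adjacent (_  ∷ _)  (here refl) (here refl) i≢j = ⊥-elim (i≢j refl)
      P-adjacent (i~ ∷ _)  (here refl) (there j∈)  _   = All.lookup i~ j∈
      P-adjacent (j~ ∷ _)  (there i∈)  (here refl) _   = ~-sym (All.lookup j~ i∈)
      P-adjacent (_  ∷ P~) (there i∈)  (there j∈)      = P-adjacent P~ i∈ j∈

      agree : ∀ {x y} → Second P v x → Second P v y → x ~ y →
              first x (missed P x) ≡ first y (missed P y)
      agree (x∈ , vx , i , x≡) (y∈ , vy , j , y≡) xy rewrite x≡ | y≡ with i ≟ᶠ j
      ... | yes i≡j = i≡j
      ... | no  i≢j = ⊥-elim (houseFree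
        (P-adjacent P~ i∈ j∈ i≢j) (~-sym (others-adjacent x≡ j∈ (i≢j ∘ ≡.sym))) xy
        (others-adjacent y≡ i∈ i≢j) (All.lookup vP i∈) (All.lookup vP j∈)
        (≁-sym xi) (≁-sym yj) vx vy)
        where
        i∈ = proj₁ (missed⇒∈ x≡)
        j∈ = proj₁ (missed⇒∈ y≡)
        xi = proj₂ (missed⇒∈ x≡)
        yj = proj₂ (missed⇒∈ y≡)

      fibre-matching : ∀ i → ¬ Matching (suc p) (Fibre i)
      fibre-matching i M@(_ , _ , (_ , _ , w≡) , _) =
        ¬M (i , v , All.lookup P∈ i∈ , v∈ , ~-sym (All.lookup vP i∈) ,
            Matching-mono (suc p) (λ (y∈ , vy , y≡) → y∈ , ≁-sym (proj₂ (missed⇒∈ y≡)) , vy) M)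
        where i∈ = proj₁ (missed⇒∈ w≡)

      fibre-ω : ∀ i → ω≤ (Fibre i) t
      fibre-ω i K (K∈ , K~) = ℕₚ.+-cancelʳ-≤ (length P) _ _
        (≤-trans (fibre-clique ω (P∈ , P~) (All.map proj₁ K∈ , K~) (All.map (proj₂ ∘ proj₂) K∈)) bound)

    -- Scanning the head of `L` splits off a group with clique number at most m + 1 - |P|, which is
    -- |L| + 1 and so the last index of the sum.
    Colourable-Late : ∀ P L → Clique S P → Clique S L → All (λ v → All (v ~_) P) L →
                      length P + length L ≡ m → Colourable (Late P L) (sum₂ g (suc (length L)))
    Colourable-Late P [] _ _ _ _ = Colourable-empty λ {w} (_ , ≤1 , 2≤) → ℕₚ.<⇒≱
      (subst (2 ≤_) (trans (cong (λ xs → length (missed P w) + length xs) missed-[]) (ℕₚ.+-identityʳ _)) 2≤) ≤1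
    Colourable-Late P (v ∷ L) (P∈ , P~) (v∈ ∷ L∈ , vL ∷ L~) (vP ∷ LP) len =
      Colourable-∪ (Late? (v ∷ P) L) Late-∷
        (Colourable-Late (v ∷ P) L (v∈ ∷ P∈ , vP ∷ P~) (L∈ , L~)
          (All.zipWith (λ (vl , lP) → ~-sym vl ∷ lP) (vL , LP)) (trans (≡.sym (ℕₚ.+-suc _ _)) len))
        (Colourable-Second (P∈ , P~) v∈ vP (ℕₚ.≤-reflexive (begin
          suc m                            ≡⟨ cong suc (≡.sym len) ⟩
          suc (length P + suc (length L))  ≡⟨ cong suc (ℕₚ.+-comm (length P) _) ⟩
          2 + length L + length P          ∎)))
      where open ≡.≡-Reasoning

    -- A clique vertex misses just itself, and a vertex missing nothing would enlarge the clique; so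
    -- everything outside the `Single` classes misses at least two.
    Colourable-clique : ∀ q L → Clique S (q ∷ L) → length (q ∷ L) ≡ m →
                        Colourable S (m + sum₂ g m)
    Colourable-clique q L Q-clique@(q∈ ∷ L∈ , qL ∷ L~) refl =
      Colourable-∪ (λ w → S? w ×-dec Single? (q ∷ L) w) cover (Colourable-Single (q ∷ L))
        (Colourable-Late (q ∷ []) L (q∈ ∷ [] , [] ∷ []) (L∈ , L~)
          (All.map (λ ql → ~-sym ql ∷ []) qL) refl)
      where
      Q : List V
      Q = q ∷ L

      -- `R` shrinks in the induction, while misses are counted in all of `Q`.
      Single : List V → VertexSet
      Single R w = ∃ λ i → i ∈ R × missed Q w ≡ i ∷ []

      Single? : ∀ R → Decidable (Single R)
      Single? R w = any? λ i → Any.any? (i ≟ᶠ_) R ×-dec List-≡-dec _≟ᶠ_ _ _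

      Colourable-Single : ∀ R → Colourable (λ w → S w × Single R w) (length R)
      Colourable-Single [] = Colourable-empty λ { (_ , _ , () , _) }
      Colourable-Single (i ∷ R) =
        Colourable-∪ (λ w → S? w ×-dec List-≡-dec _≟ᶠ_ (missed Q w) (i ∷ []))
          (λ { (w∈ , _ , here refl , w≡) w∉ → ⊥-elim (w∉ (w∈ , w≡))
             ; (w∈ , j , there j∈ , w≡) _ → w∈ , j , j∈ , w≡ })
          (Colourable-independent (ω≤1⇒independent λ K (K∈ , K~) → ℕₚ.+-cancelʳ-≤ (length Q) _ _
            (fibre-clique ω Q-clique (All.map proj₁ K∈ , K~) (All.map proj₂ K∈))))
          (Colourable-Single R)

      cover : ∀ {w} → S w → ¬ (S w × Single Q w) → Late (q ∷ []) L w
      cover {w} w∈ w∉ = w∈ , length-missed-≤ (q ∷ []) w , subst (2 ≤_) (length-missed-∷ q L w) many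
        where
        many : 2 ≤ length (missed Q w)
        many with missed Q w in eq
        ... | i ∷ []    = ⊥-elim (w∉ (w∈ , i , proj₁ (missed⇒∈ eq) , refl))
        ... | _ ∷ _ ∷ _ = s≤s (s≤s z≤n)
        ... | [] = ⊥-elim (ℕₚ.<-irrefl refl (ω (w ∷ Q) (w∈ ∷ q∈ ∷ L∈ , All.tabulate adjacent ∷ qL ∷ L~)))
          where
          adjacent : ∀ {j} → j ∈ Q → w ~ j
          adjacent j∈ = ¬≁⇒~ λ wj → case (subst (_ ∈_) eq (∈-missed⁺ j∈ wj))
            where
            case : ∀ {j} → ¬ j ∈ []
            case ()

  -- The recursive colour bound

  -- Each removed edge costs two colours and lowers the matching number by one, down to the 3K₂-free
  -- case with four colours.
  Colourable-triangleFree : HouseFree → ∀ p {S} → Decidable S → ¬ Matching (3 + p) S → ω≤ S 2 →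
                            Colourable S (4 + 2 * p)
  Colourable-triangleFree houseFree zero S? ¬M ω = 4-colourable houseFree S? ¬M ω
  Colourable-triangleFree houseFree (suc p) {S} S? ¬M ω with edge⊎independent S?
  ... | inj₂ I = Colourable-mono (λ x∈ → x∈) (s≤s z≤n) (Colourable-independent I)
  ... | inj₁ (u , v , u∈ , v∈ , uv) =
    Colourable-mono (λ x∈ → x∈) (ℕₚ.≤-reflexive (cong (4 ℕ.+_) (≡.sym (ℕₚ.*-suc 2 p))))
      (Colourable-Away S? ω u∈ v∈ (Colourable-triangleFree houseFree p (Away? S? u v)
        (λ M → ¬M (u , v , u∈ , v∈ , uv , M)) (ω≤-mono proj₁ ω)))

  -- If a clique of size `3 + m` exists, the groups around it use the bound for `p`; if not, the
  -- recursion lowers `m`.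
  Colourable-bound : HouseFree → ∀ p m {S} → Decidable S → ¬ Matching (2 + p) S → ω≤ S m →
                     Colourable S (χ-bound p m)
  Colourable-bound houseFree zero m = Colourable-2K₂-free houseFree m
  Colourable-bound houseFree (suc p) 0 S? ¬M ω = Colourable-empty (ω≤0⇒empty ω)
  Colourable-bound houseFree (suc p) 1 S? ¬M ω = Colourable-independent (ω≤1⇒independent ω)
  Colourable-bound houseFree (suc p) 2 S? ¬M ω = Colourable-triangleFree houseFree p S? ¬M ω
  Colourable-bound houseFree (suc p) (suc (suc (suc m))) {S} S? ¬M ω =
    [ around , (λ small → Colourable-mono (λ x∈ → x∈) (χ-bound-suc p m)
                  (Colourable-bound houseFree (suc p) (suc (suc m)) S? ¬M
                    λ Q Q-clique → ℕₚ.≤-pred (small Q Q-clique))) ]′ (findClique (3 + m) S?)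
    where
    around : (∃ λ Q → Clique S Q × length Q ≡ 3 + m) → Colourable S (χ-bound (suc p) (3 + m))
    around (q ∷ L , Q-clique , len) =
      AroundClique.Colourable-clique houseFree S? ¬M ω (χ-bound p)
        (λ t → Colourable-bound houseFree p t) q L Q-clique len

  -- Translation to colourings, cliques and induced subgraphs

  Everything : VertexSet
  Everything _ = ⊤

  Colourable⇒Colouring : ∀ {k} → Colourable Everything k → Colouring G k
  Colourable⇒Colouring C = (λ x → fromℕ< (C .bound {x} tt)) , λ x y xy eq → C .proper tt tt xy
    (trans (≡.sym (toℕ-fromℕ< _)) (trans (cong toℕ eq) (toℕ-fromℕ< _)))

  lookup-adjacent : ∀ {Q} → AllPairs _~_ Q → ∀ i j → i ≢ j → lookup Q i ~ lookup Q j
  lookup-adjacent (_  ∷ _)  zero    zero    i≢j = ⊥-elim (i≢j refl)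
  lookup-adjacent (q~ ∷ _)  zero    (suc j) _   = All.lookup q~ (∈-lookup j)
  lookup-adjacent (q~ ∷ _)  (suc i) zero    _   = ~-sym (All.lookup q~ (∈-lookup i))
  lookup-adjacent (_  ∷ Q~) (suc i) (suc j) i≢j = lookup-adjacent Q~ i j (i≢j ∘ cong suc)

  clique⇒HasClique : ∀ {Q} → AllPairs _~_ Q → HasClique G (length Q)
  clique⇒HasClique {Q} Q~ = lookup Q , inj , lookup-adjacent Q~
    where
    inj : ∀ {i j} → lookup Q i ≡ lookup Q j → i ≡ j
    inj {i} {j} eq with i ≟ᶠ j
    ... | yes i≡j = i≡j
    ... | no  i≢j = ⊥-elim (clash (subst (_~ lookup Q j) eq (lookup-adjacent Q~ i j i≢j)) ≁-refl)

  houseFree : G IsFreeOf co-P₅ → HouseFree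
  houseFree free {a} {b} {c} {d} {e} ab bc cd da ea eb ac bd ec ed = free (h , inj , h-adj)
    where
    -- The non-edges of the house form the path a, c, e, d, b.
    h : Fin 5 → V
    h 0F = a
    h 1F = c
    h 2F = e
    h 3F = d
    h 4F = b
    h-adj : ∀ i j → Adj co-P₅ i j ≡ Adj G (h i) (h j)
    h-adj 0F 0F = ≡.sym ≁-refl
    h-adj 0F 1F = ≡.sym ac
    h-adj 0F 2F = ≡.sym (~-sym ea)
    h-adj 0F 3F = ≡.sym (~-sym da)
    h-adj 0F 4F = ≡.sym ab
    h-adj 1F 0F = ≡.sym (≁-sym ac)
    h-adj 1F 1F = ≡.sym ≁-refl
    h-adj 1F 2F = ≡.sym (≁-sym ec)
    h-adj 1F 3F = ≡.sym cd
    h-adj 1F 4F = ≡.sym (~-sym bc)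
    h-adj 2F 0F = ≡.sym ea
    h-adj 2F 1F = ≡.sym ec
    h-adj 2F 2F = ≡.sym ≁-refl
    h-adj 2F 3F = ≡.sym ed
    h-adj 2F 4F = ≡.sym eb
    h-adj 3F 0F = ≡.sym da
    h-adj 3F 1F = ≡.sym (~-sym cd)
    h-adj 3F 2F = ≡.sym (≁-sym ed)
    h-adj 3F 3F = ≡.sym ≁-refl
    h-adj 3F 4F = ≡.sym (≁-sym bd)
    h-adj 4F 0F = ≡.sym (~-sym ab)
    h-adj 4F 1F = ≡.sym bc
    h-adj 4F 2F = ≡.sym (~-sym eb)
    h-adj 4F 3F = ≡.sym bd
    h-adj 4F 4F = ≡.sym ≁-refl
    inj : ∀ {i j} → h i ≡ h j → i ≡ j
    inj {i} {j} eq = co-P₅-rows i j λ k →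
      trans (h-adj i k) (trans (cong (λ y → Adj G y (h k)) eq) (≡.sym (h-adj j k)))

  -- Keeping the image inside `S` tells the induction step that all later vertices miss `u` and `v`.
  Matching⇒InducedIn : ∀ p {S} → Matching p S →
    Σ (pK₂ p InducedIn G) λ (h , _) → ∀ i → S (h i)
  Matching⇒InducedIn zero _ = ((λ ()) , (λ { {()} }) , λ ()) , λ ()
  Matching⇒InducedIn (suc p) {S} (u , v , u∈ , v∈ , uv , M) with Matching⇒InducedIn p M
  ... | (h , h-inj , h-adj) , h∈ = (h′ , h′-inj , h′-adj) , h′∈
    where
    h′ : Fin (2 + p * 2) → V
    h′ 0F            = u
    h′ 1F            = v
    h′ (suc (suc i)) = h i

    h′∈ : ∀ i → S (h′ i)
    h′∈ 0F            = u∈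
    h′∈ 1F            = v∈
    h′∈ (suc (suc i)) = proj₁ (h∈ i)

    u≁h : ∀ i → u ≁ h i
    u≁h i = proj₁ (proj₂ (h∈ i))

    v≁h : ∀ i → v ≁ h i
    v≁h i = proj₂ (proj₂ (h∈ i))

    h′-adj : ∀ i j → Adj (pK₂ (suc p)) i j ≡ Adj G (h′ i) (h′ j)
    h′-adj 0F 0F = ≡.sym ≁-refl
    h′-adj 0F 1F = ≡.sym uv
    h′-adj 1F 0F = ≡.sym (~-sym uv)
    h′-adj 1F 1F = ≡.sym ≁-refl
    h′-adj 0F (suc (suc j)) rewrite 2+m/2 (toℕ j) = ≡.sym (u≁h j)
    h′-adj 1F (suc (suc j)) rewrite 2+m/2 (toℕ j) = ≡.sym (v≁h j)
    h′-adj (suc (suc i)) 0F rewrite 2+m/2 (toℕ i) = ≡.sym (≁-sym (u≁h i))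
    h′-adj (suc (suc i)) 1F rewrite 2+m/2 (toℕ i) = ≡.sym (≁-sym (v≁h i))
    h′-adj (suc (suc i)) (suc (suc j)) rewrite 2+m/2 (toℕ i) | 2+m/2 (toℕ j) = h-adj i j

    h′-inj : ∀ {i j} → h′ i ≡ h′ j → i ≡ j
    h′-inj {0F} {0F} _ = refl
    h′-inj {1F} {1F} _ = refl
    h′-inj {0F} {1F} eq = ⊥-elim (clash (subst (_~ v) eq uv) ≁-refl)
    h′-inj {1F} {0F} eq = ⊥-elim (clash (subst (_~ v) (≡.sym eq) uv) ≁-refl)
    h′-inj {0F} {suc (suc j)} eq = ⊥-elim (clash (~-sym (subst (_~ v) eq uv)) (v≁h j))
    h′-inj {1F} {suc (suc j)} eq = ⊥-elim (clash (subst (u ~_) eq uv) (u≁h j))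
    h′-inj {suc (suc i)} {0F} eq = ⊥-elim (clash (~-sym (subst (_~ v) (≡.sym eq) uv)) (v≁h i))
    h′-inj {suc (suc i)} {1F} eq = ⊥-elim (clash (subst (u ~_) (≡.sym eq) uv) (u≁h i))
    h′-inj {suc (suc i)} {suc (suc j)} eq = cong (λ k → suc (suc k)) (h-inj eq)

-- Comparison with the rational bound

toℚ : ℕ → ℚ.ℚ
toℚ k = (+ k) ℚ./ 1

-- Division in `ℚ` cancels common factors; on unnormalised fractions, comparison is
-- cross-multiplication.
toℚᵘ-/ : ∀ k d .{{_ : ℕ.NonZero d}} → ℚ.toℚᵘ ((+ k) ℚ./ d) ℚᵘ.≃ (+ k) ℚᵘ./ d
toℚᵘ-/ k (suc d) = ℚₚ.toℚᵘ-fromℚᵘ (ℚᵘ.mkℚᵘ (+ k) d)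

toℚ-mono : ∀ {k l} → k ≤ l → toℚ k ℚ.≤ toℚ l
toℚ-mono {k} {l} k≤l = ℚₚ.toℚᵘ-cancel-≤ (ℚᵘₚ.≤-respˡ-≃ (ℚᵘₚ.≃-sym (toℚᵘ-/ k 1))
  (ℚᵘₚ.≤-respʳ-≃ (ℚᵘₚ.≃-sym (toℚᵘ-/ l 1)) (ℚᵘ.*≤* (ℤₚ.*-monoʳ-≤-nonNeg (+ 1) (ℤ.+≤+ k≤l)))))

toℚ-+ : ∀ k l → toℚ (k + l) ≡ toℚ k ℚ.+ toℚ l
toℚ-+ k l = ℚₚ.toℚᵘ-injective (begin
  ℚ.toℚᵘ (toℚ (k + l))                     ≈⟨ toℚᵘ-/ (k + l) 1 ⟩
  (+ (k + l)) ℚᵘ./ 1                       ≈⟨ ℚᵘ.*≡* (cong (ℤ._* + 1) (≡.sym (≡.cong₂ ℤ._+_ (ℤₚ.*-identityʳ (+ k)) (ℤₚ.*-identityʳ (+ l))))) ⟩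
  (+ k) ℚᵘ./ 1 ℚᵘ.+ (+ l) ℚᵘ./ 1           ≈⟨ ℚᵘₚ.+-cong (ℚᵘₚ.≃-sym (toℚᵘ-/ k 1)) (ℚᵘₚ.≃-sym (toℚᵘ-/ l 1)) ⟩
  ℚ.toℚᵘ (toℚ k) ℚᵘ.+ ℚ.toℚᵘ (toℚ l)       ≈⟨ ℚᵘₚ.≃-sym (ℚₚ.toℚᵘ-homo-+ (toℚ k) (toℚ l)) ⟩
  ℚ.toℚᵘ (toℚ k ℚ.+ toℚ l)                 ∎)
  where open ℚᵘₚ.≃-Reasoning

2*threeHalves≤3* : ∀ m → threeHalves m * 2 ≤ 3 * m
2*threeHalves≤3* 0 = z≤n
2*threeHalves≤3* 1 = s≤s (s≤s z≤n)
2*threeHalves≤3* (suc (suc m)) = begin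
  6 + threeHalves m * 2  ≤⟨ ℕₚ.+-monoʳ-≤ 6 (2*threeHalves≤3* m) ⟩
  6 + 3 * m              ≡⟨ ≡.sym (ℕₚ.*-distribˡ-+ 3 2 m) ⟩
  3 * (2 + m)            ∎
  where open ℕₚ.≤-Reasoning

threeHalves≤ : ∀ m → toℚ (threeHalves m) ℚ.≤ (+ (3 * m)) ℚ./ 2
threeHalves≤ m = ℚₚ.toℚᵘ-cancel-≤ (ℚᵘₚ.≤-respˡ-≃ (ℚᵘₚ.≃-sym (toℚᵘ-/ (threeHalves m) 1))
  (ℚᵘₚ.≤-respʳ-≃ (ℚᵘₚ.≃-sym (toℚᵘ-/ (3 * m) 2)) (ℚᵘ.*≤* (begin
    + threeHalves m ℤ.* + 2   ≡⟨ ≡.sym (ℤₚ.pos-* (threeHalves m) 2) ⟩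
    + (threeHalves m * 2)     ≤⟨ ℤ.+≤+ (2*threeHalves≤3* m) ⟩
    + (3 * m)                 ≡⟨ ≡.sym (ℤₚ.*-identityʳ (+ (3 * m))) ⟩
    + (3 * m) ℤ.* + 1         ∎))))
  where open ℤₚ.≤-Reasoning

sum₂≤sumFrom2 : ∀ {g g′} → (∀ m → toℚ (g m) ℚ.≤ g′ m) → ∀ m → toℚ (sum₂ g m) ℚ.≤ sumFrom2 g′ m
sum₂≤sumFrom2 g≤ 0 = ℚₚ.≤-refl
sum₂≤sumFrom2 g≤ 1 = ℚₚ.≤-refl
sum₂≤sumFrom2 {g} {g′} g≤ (suc (suc m)) =
  subst (ℚ._≤ sumFrom2 g′ (suc (suc m))) (≡.sym (toℚ-+ (sum₂ g (suc m)) (g (suc (suc m)))))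
    (ℚₚ.+-mono-≤ (sum₂≤sumFrom2 g≤ (suc m)) (g≤ (suc (suc m))))

χ-bound≤f : ∀ p m → toℚ (χ-bound p m) ℚ.≤ f (2 + p) m
χ-bound≤f zero 0 = ℚₚ.≤-refl
χ-bound≤f zero 1 = ℚₚ.≤-refl
χ-bound≤f zero (suc (suc m)) = threeHalves≤ (2 + m)
χ-bound≤f (suc p) 0 = ℚₚ.≤-refl
χ-bound≤f (suc p) 1 = ℚₚ.≤-refl
-- `4 + 2 * p` is (6 + 2p) - 2.
χ-bound≤f (suc p) 2 = toℚ-mono (ℕₚ.≤-reflexive (cong (ℕ._∸ 2) (≡.sym (ℕₚ.*-distribˡ-+ 2 3 p))))
χ-bound≤f (suc p) (suc (suc (suc m))) =
  subst (ℚ._≤ f (3 + p) (3 + m)) (≡.sym (toℚ-+ (3 + m) (sum₂ (χ-bound p) (3 + m))))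
    (ℚₚ.+-monoʳ-≤ (toℚ (3 + m)) (sum₂≤sumFrom2 (χ-bound≤f p) (3 + m)))

theorem3p14 : (p : ℕ) → 2 ≤ p → (G : Graph) →
    G IsFreeOf pK₂ p → G IsFreeOf co-P₅ →
    (χ ω : ℕ) → IsChromaticNumber G χ → IsCliqueNumber G ω →
    (+ χ) ℚ./ 1 ℚ.≤ f p ω
theorem3p14 (suc (suc p)) _ G matchingFree free χ ω (_ , χ-least) (_ , ω-greatest) =
  ℚₚ.≤-trans (toℚ-mono (χ-least _ (Colourable⇒Colouring
    (Colourable-bound (houseFree free) p ω (λ _ → yes tt)
      (matchingFree ∘ proj₁ ∘ Matching⇒InducedIn (2 + p))
      (λ Q (_ , Q~) → ω-greatest _ (clique⇒HasClique Q~))))))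
    (χ-bound≤f p ω)
  where open Graphs G
theorem3p14 1 (s≤s ())
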